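{- Let $r\ge 1$, let $a_r>\cdots>a_1>a_0\ge 2$ be integers, and choose $k\in\{1,\dots,r-1\}$. Then, for fixed $a_0,\dots,a_k$ and $a_{k+1},\dots,a_r\to\infty$, the Salem root $\tau(a_0,\dots,a_r)$ of the Coxeter polynomial associated with $T(a_0,\dots,a_r)$ converges to the dominant Pisot root of $$Q(z)=(z+1-r+k)\prod_{i=0}^{k}(z^{a_i}-1)-z\sum_{i=0}^{k}(z^{a_i-1}-1)\prod_{\substack{j=0\\ j\neq i}}^{k}(z^{a_j}-1),$$ i.e. to the root of $Q$ of largest modulus, which is a Pisot number.
   Context: For integers $a_0,\dots,a_r\ge 2$, the star-like tree $T(a_0,\dots,a_r)$ is the tree consisting of $r+1$ arms (paths) with $a_0-1,\dots,a_r-1$ edges, respectively, all emanating from one common central vertex. Its Coxeter polynomial is given by $$R_{T(a_0,\dots,a_r)}(z)=\prod_{i=0}^{r}\Bigl(\frac{z^{a_i}-1}{z-1}\Bigr)\Bigl(z+1-z\sum_{i=0}^{r}\frac{z^{a_i-1}-1}{z^{a_i}-1}\Bigr).$$ The Salem root $\tau(a_0,\dots,a_r)$ is the unique root of modulus greater than $1$ of this polynomial (it exists for $a_{k+1},\dots,a_r$ sufficiently large); it is real and $>1$, and is a Salem number or a quadratic Pisot number. A Pisot number is a real algebraic integer $>1$ all of whose other conjugates have modulus $<1$. The limit $a_{k+1},\dots,a_r\to\infty$ is taken over integers subject to $a_k<a_{k+1}<\cdots<a_r$, with all of $a_{k+1},\dots,a_r$ tending to infinity. -}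

module Defs where

open import Algebra.Bundles using (CommutativeRing; RawRing; Semiring)
import Algebra.Definitions.RawSemiring as RawSemiringDefinitions
open import Data.Fin.Base using (toℕ)
import Data.Fin.Base as Fin
open import Data.Integer.Base using (ℤ; +_; -[1+_])
open import Data.Nat.Base using (ℕ; suc; _∸_)
import Data.Nat.Base as ℕ
open import Data.Product using (∃; ∃-syntax; _×_; _,_; proj₁)
open import Data.Rational.Base using (ℚ; ↥_; ↧ₙ_)
open import Data.Sum.Base using (_⊎_; inj₁; inj₂)
open import Data.Vec.Functional using (Vector; removeAt)
open import Level using (0ℓ) renaming (suc to lsuc)
open import Relation.Binary.Core using (Rel; _Preserves_⟶_)
open import Relation.Binary.Definitions using (tri<; tri≈; tri>)
open import Relation.Binary.Structures using (IsStrictTotalOrder)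
import Relation.Binary.Construct.StrictToNonStrict as StrictToNonStrict
open import Relation.Nullary.Negation using (¬_; contradiction)

-- The axioms characterising the real numbers (up to isomorphism, classically).
record CompleteOrderedField : Set (lsuc 0ℓ) where
  infix 4 _<_
  infix 9 _⁻¹
  field
    commutativeRing : CommutativeRing 0ℓ 0ℓ
  open CommutativeRing commutativeRing public
  field
    -- As usual for a total inverse, nothing is assumed about 0# ⁻¹.
    _⁻¹                : Carrier → Carrier
    ⁻¹-inverseʳ        : ∀ x → ¬ x ≈ 0# → x * x ⁻¹ ≈ 1#
    _<_                : Rel Carrier 0ℓ
    isStrictTotalOrder : IsStrictTotalOrder _≈_ _<_
    0<1                : 0# < 1#
    +-monoʳ-<          : ∀ x {y z} → y < z → x + y < x + z
    *-pos              : ∀ {x y} → 0# < x → 0# < y → 0# < x * y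

  open StrictToNonStrict _≈_ _<_ public using (_≤_)

  IsUpperBound : (Carrier → Set) → Carrier → Set
  IsUpperBound S b = ∀ {x} → S x → x ≤ b

  IsLeastUpperBound : (Carrier → Set) → Carrier → Set
  IsLeastUpperBound S s = IsUpperBound S s × (∀ {b} → IsUpperBound S b → s ≤ b)

  field
    complete : (S : Carrier → Set) → ∃ S → ∃ (IsUpperBound S) →
               ∃ (IsLeastUpperBound S)

module RealAndComplex (ℝ : CompleteOrderedField) where

  private
    module ℝ = CompleteOrderedField ℝ
    module ℝ× = RawSemiringDefinitions (Semiring.rawSemiring ℝ.semiring)
    open ℝ using (_<_; _≤_)
    module < = IsStrictTotalOrder ℝ.isStrictTotalOrder

  fromℤ : ℤ → ℝ.Carrier
  fromℤ (+ n)    = n ℝ×.× ℝ.1#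
  fromℤ -[1+ n ] = ℝ.- (suc n ℝ×.× ℝ.1#)

  fromℚ : ℚ → ℝ.Carrier
  fromℚ p = fromℤ (↥ p) ℝ.* (↧ₙ p ℝ×.× ℝ.1#) ℝ.⁻¹

  -- For x < ℝ.0# the set is still inhabited, and √ x is then ℝ.0#.
  SqrtSet : ℝ.Carrier → ℝ.Carrier → Set
  SqrtSet x t = t ≤ ℝ.0# ⊎ t ℝ.* t ≤ x

  ≤-<-trans : ∀ {x y z} → x ≤ y → y < z → x < z
  ≤-<-trans (inj₁ x<y) y<z = <.trans x<y y<z
  ≤-<-trans (inj₂ x≈y) y<z = <.<-respˡ-≈ (ℝ.sym x≈y) y<z

  ≮⇒≥ : ∀ {x y} → ¬ x < y → y ≤ x
  ≮⇒≥ {x} {y} x≮y with <.compare x y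
  ... | tri< x<y _ _ = contradiction x<y x≮y
  ... | tri≈ _ x≈y _ = inj₂ (ℝ.sym x≈y)
  ... | tri> _ _ y<x = inj₁ y<x

  1<t⇒t<t² : ∀ {t} → ℝ.1# < t → t < t ℝ.* t
  1<t⇒t<t² {t} 1<t = <.<-respˡ-≈ (ℝ.+-identityʳ t)
    (<.<-respʳ-≈ t+t[t-1]≈t² (ℝ.+-monoʳ-< t (ℝ.*-pos 0<t 0<t-1)))
    where
    open import Relation.Binary.Reasoning.Setoid ℝ.setoid
    t-1 = ℝ.- ℝ.1# ℝ.+ t
    0<t = <.trans ℝ.0<1 1<t
    0<t-1 : ℝ.0# < t-1
    0<t-1 = <.<-respˡ-≈ (ℝ.-‿inverseˡ ℝ.1#) (ℝ.+-monoʳ-< (ℝ.- ℝ.1#) 1<t)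
    t+t[t-1]≈t² : t ℝ.+ t ℝ.* t-1 ℝ.≈ t ℝ.* t
    t+t[t-1]≈t² = begin
      t ℝ.+ t ℝ.* t-1                       ≈⟨ ℝ.+-congʳ (ℝ.*-identityʳ t) ⟨
      t ℝ.* ℝ.1# ℝ.+ t ℝ.* t-1              ≈⟨ ℝ.distribˡ t ℝ.1# t-1 ⟨
      t ℝ.* (ℝ.1# ℝ.+ t-1)                  ≈⟨ ℝ.*-congˡ (ℝ.+-assoc ℝ.1# (ℝ.- ℝ.1#) t) ⟨
      t ℝ.* (ℝ.1# ℝ.+ ℝ.- ℝ.1# ℝ.+ t)       ≈⟨ ℝ.*-congˡ (ℝ.+-congʳ (ℝ.-‿inverseʳ ℝ.1#)) ⟩
      t ℝ.* (ℝ.0# ℝ.+ t)                    ≈⟨ ℝ.*-congˡ (ℝ.+-identityˡ t) ⟩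
      t ℝ.* t                               ∎

  sqrtSet-bounded : ∀ x → ∃ (ℝ.IsUpperBound (SqrtSet x))
  sqrtSet-bounded x = b , λ t∈S → ≮⇒≥ λ b<t → above t∈S b<t
    where
    max : ∃[ b ] ℝ.1# ≤ b × x ≤ b
    max with <.compare ℝ.1# x
    ... | tri< 1<x _ _ = x  , inj₁ 1<x , inj₂ ℝ.refl
    ... | tri≈ _ 1≈x _ = ℝ.1# , inj₂ ℝ.refl , inj₂ (ℝ.sym 1≈x)
    ... | tri> _ _ x<1 = ℝ.1# , inj₂ ℝ.refl , inj₁ x<1
    b = proj₁ max
    above : ∀ {t} → SqrtSet x t → ¬ b < t
    above {t} t∈S b<t with max
    ... | _ , 1≤b , x≤b with t∈S
    ... | inj₁ t≤0  = <.irrefl ℝ.refl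
            (≤-<-trans t≤0 (<.trans ℝ.0<1 (≤-<-trans 1≤b b<t)))
    ... | inj₂ t²≤x = <.irrefl ℝ.refl
            (≤-<-trans t²≤x (≤-<-trans x≤b
              (<.trans b<t (1<t⇒t<t² (≤-<-trans 1≤b b<t)))))

  √ : ℝ.Carrier → ℝ.Carrier
  √ x = proj₁ (ℝ.complete (SqrtSet x) (ℝ.0# , inj₁ (inj₂ ℝ.refl)) (sqrtSet-bounded x))

  -- (x , y) stands for x + iy.
  ℂ-rawRing : RawRing 0ℓ 0ℓ
  ℂ-rawRing = record
    { Carrier = ℝ.Carrier × ℝ.Carrier
    ; _≈_     = λ { (x , y) (u , v) → x ℝ.≈ u × y ℝ.≈ v }
    ; _+_     = λ { (x , y) (u , v) → x ℝ.+ u , y ℝ.+ v }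
    ; _*_     = λ { (x , y) (u , v) →
                    x ℝ.* u ℝ.- y ℝ.* v , x ℝ.* v ℝ.+ y ℝ.* u }
    ; -_      = λ { (x , y) → ℝ.- x , ℝ.- y }
    ; 0#      = ℝ.0# , ℝ.0#
    ; 1#      = ℝ.1# , ℝ.0#
    }

  module ℂ where
    open RawRing ℂ-rawRing public
    open RawSemiringDefinitions rawSemiring public
      using (sum; product; _^_) renaming (_×_ to _·_)

    infixl 6 _-_
    infixl 7 _/_
    infix  9 _⁻¹

    _-_ : Carrier → Carrier → Carrier
    z - w = z + - w

    fromℝ : ℝ.Carrier → Carrier
    fromℝ x = x , ℝ.0#

    fromℕ : ℕ → Carrier
    fromℕ n = n · 1#

    normSq : Carrier → ℝ.Carrier
    normSq (x , y) = x ℝ.* x ℝ.+ y ℝ.* y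

    _⁻¹ : Carrier → Carrier
    (x , y) ⁻¹ = x ℝ.* n⁻¹ , ℝ.- y ℝ.* n⁻¹
      where n⁻¹ = normSq (x , y) ℝ.⁻¹

    _/_ : Carrier → Carrier → Carrier
    z / w = z * w ⁻¹

    ∣_∣ : Carrier → ℝ.Carrier
    ∣ z ∣ = √ (normSq z)

  open ℂ

  -- The monic polynomial of degree d with lower coefficients c, evaluated at z.
  monicEval : ∀ {A : Set} (ι : A → ℝ.Carrier) {d} → Vector A d → Carrier → Carrier
  monicEval ι {d} c z = z ^ d + sum (λ i → fromℝ (ι (c i)) * z ^ toℕ i)

  IsAlgebraicInteger : Carrier → Set
  IsAlgebraicInteger z = ∃[ d ] ∃[ c ] monicEval fromℤ {d} c z ≈ 0#

  IsMinimalPolynomial : ∀ {d} → Vector ℚ d → Carrier → Set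
  IsMinimalPolynomial {d} c z =
    monicEval fromℚ c z ≈ 0# ×
    (∀ {e} (c′ : Vector ℚ e) → monicEval fromℚ c′ z ≈ 0# → d ℕ.≤ e)

  IsConjugate : Carrier → Carrier → Set
  IsConjugate z w = ∃[ d ] ∃[ c ]
    IsMinimalPolynomial {d} c z × monicEval fromℚ c w ≈ 0#

  IsPisot : ℝ.Carrier → Set
  IsPisot θ =
    IsAlgebraicInteger (fromℝ θ) × ℝ.1# < θ ×
    (∀ w → IsConjugate (fromℝ θ) w → ¬ w ≈ fromℝ θ → ∣ w ∣ < ℝ.1#)

  -- The Coxeter polynomial of T(a₀,…,aᵣ).  As a quotient of polynomials it is
  -- only meaningful where no denominator vanishes, in particular for ∣ z ∣ > 1,
  -- where the Salem root lives; its roots of modulus 1 play no role.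
  coxeterPolynomial : ∀ {r} → Vector ℕ (suc r) → Carrier → Carrier
  coxeterPolynomial a z =
    product (λ i → (z ^ a i - 1#) / (z - 1#)) *
    (z + 1# - z * sum (λ i → (z ^ (a i ∸ 1) - 1#) / (z ^ a i - 1#)))

  IsSalemRoot : ∀ {r} → Vector ℕ (suc r) → ℝ.Carrier → Set
  IsSalemRoot a τ =
    ℝ.1# < τ × coxeterPolynomial a (fromℝ τ) ≈ 0# ×
    (∀ w → coxeterPolynomial a w ≈ 0# → ℝ.1# < ∣ w ∣ → w ≈ fromℝ τ)

  Q : (r k : ℕ) → Vector ℕ (suc k) → Carrier → Carrier
  Q r k a z =
    (z + 1# - fromℕ r + fromℕ k) * product (λ i → z ^ a i - 1#)
    - z * sum (λ i → (z ^ (a i ∸ 1) - 1#) *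
                     product (removeAt (λ j → z ^ a j - 1#) i))

  IsDominantRoot : (Carrier → Carrier) → Carrier → Set
  IsDominantRoot f z =
    f z ≈ 0# × (∀ w → f w ≈ 0# → ¬ w ≈ z → ∣ w ∣ < ∣ z ∣)

StrictlyIncreasing : ∀ {n} → Vector ℕ n → Set
StrictlyIncreasing a = a Preserves Fin._<_ ⟶ ℕ._<_

{-# OPTIONS --safe #-}

-- Put f_a(z) = (zᵃ - z)/(zᵃ - 1), the value of an arm, so that f_{a+1}(z + 1 - f_a) = z
-- and f_1 = 0; an infinite arm has the value 1.  For ∣z∣ > 1 the Coxeter polynomial
-- vanishes iff z + 1 = Σ f_{aᵢ}, and Q(z) = ∏(z^{aᵢ} - 1) (z + 1 - m - Σ f_{aᵢ}) with
-- m = r - k infinite arms.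
--
-- If z is not a positive real and v is the conjugate of a square root of z, the
-- recurrence keeps f_a v in the closed lower half-plane while (z + 1) v lies in the
-- upper one, so the roots outside the unit circle are real numbers x > 1.  For these
-- f_a(x)/(x + 1) is strictly decreasing, which leaves at most one root, while f_a is
-- increasing, which makes the supremum argument for existence work.  Since
-- 0 < 1 - f_a(x) ≤ 1/a, replacing the infinite arms by long ones moves the root θ only
-- slightly down.
--
-- On the unit circle f_a v is real, so a root w of Q there has w^{aᵢ} = 1 for some i.
-- If w were a conjugate of θ, then also θ^{aᵢ} = 1, which is absurd; hence θ is Pisot.

module Submission where

open import Defs
open import Algebra.Bundles using (CommutativeRing; RawRing; Semiring)
import Algebra.Definitions.RawSemiring as RawSemiringDefinitions
open import Algebra.Morphism.Structures using (IsRingHomomorphism)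
open import Axiom.ExcludedMiddle using (ExcludedMiddle)
open import Data.Fin.Base using (zero; suc; toℕ; inject≤)
open import Data.Integer.Base using (ℤ; +_; -[1+_])
import Data.Integer.Base as ℤ
import Data.Integer.Properties as ℤ
open import Data.Maybe.Base using (Maybe; just; nothing)
open import Data.Nat.Base using (ℕ; zero; suc; z≤n; s≤s)
import Data.Nat.Base as ℕ
import Data.Nat.Properties as ℕ
open import Data.Product using (∃-syntax; _×_; _,_; proj₁; proj₂)
open import Data.Rational.Base using (ℚ; mkℚ; toℚᵘ)
import Data.Rational.Base as ℚ
import Data.Rational.Properties as ℚ
open import Data.Rational.Unnormalised.Base using (ℚᵘ; mkℚᵘ; *≡*)
import Data.Rational.Unnormalised.Base as ℚᵘ
open import Data.Sum.Base using (_⊎_; inj₁; inj₂)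
open import Data.Vec.Functional using (Vector; []; _∷_; tail; removeAt)
open import Function.Base using (_∘_)
open import Level using (0ℓ)
open import Relation.Binary.Definitions using (tri<; tri≈; tri>)
import Relation.Binary.Construct.StrictToNonStrict as StrictToNonStrict
open import Relation.Binary.PropositionalEquality as ≡ using (_≡_)
open import Relation.Binary.Structures using (IsPartialOrder; IsStrictTotalOrder)
open import Relation.Nullary using (¬_; yes; no; contradiction)

-- The half-plane argument rests on one identity. Since `v` makes z v² = ∣z∣ ∣v∣² real and positive,
-- the recurrence says that f_{a+1} v and (z + 1 - f_a) v have a positive product, so their
-- imaginary parts have opposite signs; the induction on a starts at f_1 = 0. On the unit circle the
-- strictness coming from ∣z∣ > 1 is lost: (z + 1) v and every finite f_a v are real there, and it
-- is the infinite arms, each contributing `v` itself, that keep the imaginary part away from zero.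
-- This is one place where k < r enters.
--
-- The real arms are defined by the recurrence because the quotient is 0/0 at x = 1, and the
-- existence of θ is read off exactly there: f_a(1) = 1 - 1/a, so an infinite arm together with
-- finite ones for a ≥ 2 and a ≥ 3 makes z + 1 - Σ f negative at 1, by 1/2 + 1/3 < 1.

-- Ring solver with integer constants over an arbitrary commutative ring.

module IntegerSolver (R : CommutativeRing 0ℓ 0ℓ) where
  open CommutativeRing R
  open import Algebra.Properties.Ring ring
    using (-‿involutive; -‿distribˡ-*; -‿distribʳ-*; -‿+-comm; -0#≈0#)
  open import Algebra.Properties.Semiring.Mult.TCOptimised semiring
    using (×-homo-+; ×1-homo-*; 1+×) renaming (_×_ to _·_)
  open import Algebra.Solver.Ring.AlmostCommutativeRing
    using (AlmostCommutativeRing; fromCommutativeRing; _-Raw-AlmostCommutative⟶_)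
  open import Relation.Binary.Reasoning.Setoid setoid

  -- The optimised multiple makes `⟦ + 1 ⟧ℤ` compute to `1#` and not to `1# + 0#`, so that
  -- `con (+ 1)` matches a literal one in the goals.
  ⟦_⟧ℤ : ℤ → Carrier
  ⟦ + n ⟧ℤ      = n · 1#
  ⟦ -[1+ n ] ⟧ℤ = - (suc n · 1#)

  ⟦⟧-‿homo : ∀ i → ⟦ ℤ.- i ⟧ℤ ≈ - ⟦ i ⟧ℤ
  ⟦⟧-‿homo (+ zero)   = sym -0#≈0#
  ⟦⟧-‿homo (+ suc n)  = refl
  ⟦⟧-‿homo -[1+ n ]   = sym (-‿involutive _)

  ⟦⊖⟧ : ∀ m n → ⟦ m ℤ.⊖ n ⟧ℤ ≈ m · 1# - n · 1#
  ⟦⊖⟧ m zero = sym (trans (+-congˡ -0#≈0#) (+-identityʳ _))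
  ⟦⊖⟧ zero (suc n) = sym (+-identityˡ _)
  ⟦⊖⟧ (suc m) (suc n) = begin
    ⟦ suc m ℤ.⊖ suc n ⟧ℤ               ≡⟨ ≡.cong ⟦_⟧ℤ (ℤ.[1+m]⊖[1+n]≡m⊖n m n) ⟩
    ⟦ m ℤ.⊖ n ⟧ℤ                       ≈⟨ ⟦⊖⟧ m n ⟩
    m · 1# - n · 1#                    ≈⟨ +-congʳ (+-identityʳ _) ⟨
    m · 1# + 0# - n · 1#               ≈⟨ +-congʳ (+-congˡ (-‿inverseʳ 1#)) ⟨
    m · 1# + (1# - 1#) - n · 1#        ≈⟨ +-congʳ (+-assoc _ _ _) ⟨
    m · 1# + 1# - 1# - n · 1#          ≈⟨ +-assoc _ _ _ ⟩
    m · 1# + 1# + (- 1# - n · 1#)      ≈⟨ +-cong (trans (+-comm _ _) (sym (1+× m 1#))) (-‿+-comm _ _) ⟩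
    suc m · 1# - (1# + n · 1#)         ≈⟨ +-congˡ (-‿cong (sym (1+× n 1#))) ⟩
    suc m · 1# - suc n · 1#            ∎

  ⟦⟧-+-homo : ∀ i j → ⟦ i ℤ.+ j ⟧ℤ ≈ ⟦ i ⟧ℤ + ⟦ j ⟧ℤ
  ⟦⟧-+-homo (+ m)    (+ n)    = ×-homo-+ 1# m n
  ⟦⟧-+-homo (+ m)    -[1+ n ] = ⟦⊖⟧ m (suc n)
  ⟦⟧-+-homo -[1+ m ] (+ n)    = trans (⟦⊖⟧ n (suc m)) (+-comm _ _)
  ⟦⟧-+-homo -[1+ m ] -[1+ n ] = begin
    - (suc (suc (m ℕ.+ n)) · 1#)   ≡⟨ ≡.cong (λ k → - (suc k · 1#)) (ℕ.+-suc m n) ⟨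
    - ((suc m ℕ.+ suc n) · 1#)     ≈⟨ -‿cong (×-homo-+ 1# (suc m) (suc n)) ⟩
    - (suc m · 1# + suc n · 1#)    ≈⟨ -‿+-comm _ _ ⟨
    - (suc m · 1#) - suc n · 1#    ∎

  ⟦⟧-*-homo⁺ : ∀ m j → ⟦ + m ℤ.* j ⟧ℤ ≈ m · 1# * ⟦ j ⟧ℤ
  ⟦⟧-*-homo⁺ m (+ n) = begin
    ⟦ + m ℤ.* + n ⟧ℤ   ≡⟨ ≡.cong ⟦_⟧ℤ (ℤ.pos-* m n) ⟨
    (m ℕ.* n) · 1#     ≈⟨ ×1-homo-* m n ⟩
    m · 1# * n · 1#    ∎
  ⟦⟧-*-homo⁺ m j@(-[1+ n ]) = begin
    ⟦ + m ℤ.* j ⟧ℤ                ≡⟨ ≡.cong ⟦_⟧ℤ (ℤ.neg-distribʳ-* (+ m) (+ suc n)) ⟨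
    ⟦ ℤ.- (+ m ℤ.* + suc n) ⟧ℤ    ≈⟨ ⟦⟧-‿homo (+ m ℤ.* + suc n) ⟩
    - ⟦ + m ℤ.* + suc n ⟧ℤ        ≈⟨ -‿cong (⟦⟧-*-homo⁺ m (+ suc n)) ⟩
    - (m · 1# * suc n · 1#)       ≈⟨ -‿distribʳ-* _ _ ⟩
    m · 1# * - (suc n · 1#)       ∎

  ⟦⟧-*-homo : ∀ i j → ⟦ i ℤ.* j ⟧ℤ ≈ ⟦ i ⟧ℤ * ⟦ j ⟧ℤ
  ⟦⟧-*-homo (+ m)      j = ⟦⟧-*-homo⁺ m j
  ⟦⟧-*-homo i@(-[1+ m ]) j = begin
    ⟦ i ℤ.* j ⟧ℤ                 ≡⟨ ≡.cong ⟦_⟧ℤ (ℤ.neg-distribˡ-* (+ suc m) j) ⟨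
    ⟦ ℤ.- (+ suc m ℤ.* j) ⟧ℤ     ≈⟨ ⟦⟧-‿homo (+ suc m ℤ.* j) ⟩
    - ⟦ + suc m ℤ.* j ⟧ℤ         ≈⟨ -‿cong (⟦⟧-*-homo⁺ (suc m) j) ⟩
    - (suc m · 1# * ⟦ j ⟧ℤ)      ≈⟨ -‿distribˡ-* _ _ ⟩
    - (suc m · 1#) * ⟦ j ⟧ℤ      ∎

  almostCommutativeRing : AlmostCommutativeRing 0ℓ 0ℓ
  almostCommutativeRing = fromCommutativeRing R

  ⟦⟧-morphism : ℤ.+-*-rawRing -Raw-AlmostCommutative⟶ almostCommutativeRing
  ⟦⟧-morphism = record
    { ⟦_⟧ = ⟦_⟧ℤ ; +-homo = ⟦⟧-+-homo ; *-homo = ⟦⟧-*-homo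
    ; -‿homo = ⟦⟧-‿homo ; 0-homo = refl ; 1-homo = refl }

  ⟦⟧-≟ : ∀ i j → Maybe (⟦ i ⟧ℤ ≈ ⟦ j ⟧ℤ)
  ⟦⟧-≟ i j with i ℤ.≟ j
  ... | yes i≡j = just (reflexive (≡.cong ⟦_⟧ℤ i≡j))
  ... | no _    = nothing

  open import Algebra.Solver.Ring ℤ.+-*-rawRing almostCommutativeRing ⟦⟧-morphism ⟦⟧-≟ public
    using (solve; _:=_; _:+_; _:*_; _:-_; :-_; con)

-- Polynomial functions with coefficients in a subring, division, minimal polynomials.

module PolynomialFunctions
  (R : CommutativeRing 0ℓ 0ℓ) (A : RawRing 0ℓ 0ℓ)
  (κ : RawRing.Carrier A → CommutativeRing.Carrier R)
  (κ-homo : IsRingHomomorphism A (CommutativeRing.rawRing R) κ)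
  where
  open CommutativeRing R hiding (zero)
  open RawSemiringDefinitions (Semiring.rawSemiring semiring)
    using (sum; product; _^_) renaming (_×_ to _·_)
  open import Algebra.Properties.Semiring.Sum semiring
    using (sum-cong-≋; *-distribˡ-sum)
  open IntegerSolver R
  open import Relation.Binary.Reasoning.Setoid setoid
  private
    module A = RawRing A
    module κ = IsRingHomomorphism κ-homo

  -- Poly l d p: the function p is given by a polynomial l zᵈ + (lower terms)
  -- whose coefficients, l included, come from A; so Poly 0# d means degree < d.
  data Poly : Carrier → ℕ → (Carrier → Carrier) → Set where
    const : ∀ {l p} a → κ a ≈ l → (∀ z → p z ≈ l) → Poly l 0 p
    cons  : ∀ {l d p q} a → Poly l d p → (∀ z → q z ≈ κ a + z * p z) → Poly l (suc d) q

  private variable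
    l m : Carrier
    d e : ℕ
    p q : Carrier → Carrier

  Poly-lead : l ≈ m → Poly l d p → Poly m d p
  Poly-lead l≈m (const a κa≈l p≈l) = const a (trans κa≈l l≈m) (λ z → trans (p≈l z) l≈m)
  Poly-lead l≈m (cons a P p≈)      = cons a (Poly-lead l≈m P) p≈

  Poly-resp : (∀ z → q z ≈ p z) → Poly l d p → Poly l d q
  Poly-resp q≈p (const a κa≈l p≈l) = const a κa≈l (λ z → trans (q≈p z) (p≈l z))
  Poly-resp q≈p (cons a P p≈)      = cons a P (λ z → trans (q≈p z) (p≈ z))

  Poly-+ : Poly l d p → Poly m d q → Poly (l + m) d (λ z → p z + q z)
  Poly-+ (const a κa≈l p≈l) (const b κb≈m q≈m) =
    const (a A.+ b) (trans (κ.+-homo a b) (+-cong κa≈l κb≈m)) (λ z → +-cong (p≈l z) (q≈m z))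
  Poly-+ {p = p} {q = q} (cons {p = p′} a P p≈) (cons {p = q′} b Q q≈) =
    cons (a A.+ b) (Poly-+ P Q) λ z → begin
      p z + q z                              ≈⟨ +-cong (p≈ z) (q≈ z) ⟩
      κ a + z * p′ z + (κ b + z * q′ z)
        ≈⟨ solve 5 (λ a b z p q → a :+ z :* p :+ (b :+ z :* q)
            := a :+ b :+ z :* (p :+ q)) refl (κ a) (κ b) z (p′ z) (q′ z) ⟩
      κ a + κ b + z * (p′ z + q′ z)          ≈⟨ +-congʳ (κ.+-homo a b) ⟨
      κ (a A.+ b) + z * (p′ z + q′ z)        ∎

  Poly-scale : ∀ a → Poly l d p → Poly (κ a * l) d (λ z → κ a * p z)
  Poly-scale a (const b κb≈l p≈l) =
    const (a A.* b) (trans (κ.*-homo a b) (*-congˡ κb≈l)) (λ z → *-congˡ (p≈l z))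
  Poly-scale {p = p} a (cons {p = p′} b P p≈) =
    cons (a A.* b) (Poly-scale a P) λ z → begin
      κ a * p z                        ≈⟨ *-congˡ (p≈ z) ⟩
      κ a * (κ b + z * p′ z)
        ≈⟨ solve 4 (λ a b z p → a :* (b :+ z :* p) := a :* b :+ z :* (a :* p)) refl (κ a) (κ b) z (p′ z) ⟩
      κ a * κ b + z * (κ a * p′ z)     ≈⟨ +-congʳ (κ.*-homo a b) ⟨
      κ (a A.* b) + z * (κ a * p′ z)   ∎

  Poly-neg : Poly l d p → Poly (- l) d (λ z → - p z)
  Poly-neg P = Poly-lead (neg _) (Poly-resp (λ z → sym (neg _)) (Poly-scale (A.- A.1#) P))
    where
    neg : ∀ x → κ (A.- A.1#) * x ≈ - x
    neg x = begin
      κ (A.- A.1#) * x   ≈⟨ *-congʳ (trans (κ.-‿homo _) (-‿cong κ.1#-homo)) ⟩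
      - 1# * x           ≈⟨ solve 1 (λ x → :- con (+ 1) :* x := :- x) refl x ⟩
      - x                ∎

  Poly-- : Poly l d p → Poly m d q → Poly (l - m) d (λ z → p z - q z)
  Poly-- P Q = Poly-+ P (Poly-neg Q)

  Poly-shift : Poly l d p → Poly l (suc d) (λ z → z * p z)
  Poly-shift P = cons A.0# P λ z → sym (trans (+-congʳ κ.0#-homo) (+-identityˡ _))

  Poly-raise : Poly l d p → Poly 0# (suc d) p
  Poly-raise {p = p} (const a κa≈l p≈l) = cons a (const A.0# κ.0#-homo (λ _ → refl)) λ z → begin
    p z            ≈⟨ trans (p≈l z) (sym κa≈l) ⟩
    κ a            ≈⟨ +-identityʳ _ ⟨
    κ a + 0#       ≈⟨ +-congˡ (zeroʳ z) ⟨
    κ a + z * 0#   ∎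
  Poly-raise (cons a P p≈) = cons a (Poly-raise P) p≈

  Poly-raise-by : ∀ k → Poly l d p → Poly 0# (suc k ℕ.+ d) p
  Poly-raise-by zero    P = Poly-raise P
  Poly-raise-by (suc k) P = Poly-raise (Poly-raise-by k P)

  Poly-* : Poly l d p → Poly m e q → Poly (l * m) (d ℕ.+ e) (λ z → p z * q z)
  Poly-* (const a κa≈l p≈l) Q =
    Poly-lead (*-congʳ κa≈l) (Poly-resp (λ z → *-congʳ (trans (p≈l z) (sym κa≈l))) (Poly-scale a Q))
  Poly-* {p = p} {q = q} (cons {d = d} {p = p′} a P p≈) Q =
    Poly-lead (+-identityˡ _)
      (Poly-resp (λ z → trans (*-congʳ (p≈ z))
          (solve 4 (λ a z p q → (a :+ z :* p) :* q := a :* q :+ z :* (p :* q)) refl (κ a) z (p′ z) (q z)))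
        (Poly-+ (Poly-raise-by d (Poly-scale a Q)) (Poly-shift (Poly-* P Q))))

  -- Division needs the next coefficient as an element of `A`, to become a coefficient of the
  -- quotient; the index of `Poly` knows it only as a value in `R`.
  Poly-lower : Poly 0# (suc d) p → ∃[ a ] Poly (κ a) d p
  Poly-lower {p = q} (cons {p = p} a (const b κb≈0 p≈0) q≈) = a , const a refl λ z → begin
    q z             ≈⟨ q≈ z ⟩
    κ a + z * p z   ≈⟨ +-congˡ (*-congˡ (p≈0 z)) ⟩
    κ a + z * 0#    ≈⟨ +-congˡ (zeroʳ z) ⟩
    κ a + 0#        ≈⟨ +-identityʳ _ ⟩
    κ a             ∎
  Poly-lower (cons a P@(cons _ _ _) q≈) with Poly-lower P
  ... | b , P′ = b , cons a P′ q≈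

  Poly-1 : Poly 1# 0 (λ _ → 1#)
  Poly-1 = const A.1# κ.1#-homo (λ _ → refl)

  Poly-^ : ∀ n → Poly 1# n (_^ n)
  Poly-^ zero    = Poly-1
  Poly-^ (suc n) = Poly-shift (Poly-^ n)

  Poly-^-1 : ∀ n → Poly 1# (suc n) (λ z → z ^ suc n - 1#)
  Poly-^-1 n = Poly-lead (+-identityʳ 1#)
    (Poly-+ (Poly-^ (suc n))
      (≡.subst (λ k → Poly 0# (suc k) (λ _ → - 1#)) (ℕ.+-identityʳ n) (Poly-raise-by n (Poly-neg Poly-1))))

  Poly-product : ∀ {n} (D : Vector ℕ n) (f : Vector (Carrier → Carrier) n) →
                 (∀ i → Poly 1# (D i) (f i)) →
                 Poly 1# (RawSemiringDefinitions.sum ℕ.+-*-rawSemiring D) (λ z → product (λ i → f i z))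
  Poly-product {zero}  D f F = Poly-1
  Poly-product {suc n} D f F =
    Poly-lead (*-identityˡ 1#) (Poly-* (F zero) (Poly-product (tail D) (tail f) (F ∘ suc)))

  Poly-sum : ∀ {n} (f : Vector (Carrier → Carrier) n) →
             (∀ i → Poly 0# d (f i)) → Poly 0# d (λ z → sum (λ i → f i z))
  Poly-sum {d = d} {n = zero} f F = Poly-0 d
    where
    Poly-0 : ∀ d → Poly 0# d (λ _ → 0#)
    Poly-0 zero    = const A.0# κ.0#-homo (λ _ → refl)
    Poly-0 (suc d) = Poly-raise (Poly-0 d)
  Poly-sum {n = suc n} f F = Poly-lead (+-identityʳ 0#) (Poly-+ (F zero) (Poly-sum (tail f) (F ∘ suc)))

  -- Division in Horner form: once the inner polynomial `q′` is divided, `κ c + z * t z` may reach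
  -- degree `d`, and its coefficient `a` there becomes the constant term of the new quotient.
  Poly-divMod : Poly 1# d p → ∀ e → Poly 1# (e ℕ.+ d) q →
                ∃[ s ] ∃[ t ] Poly 1# e s × Poly 0# d t × (∀ z → q z ≈ p z * s z + t z)
  Poly-divMod {p = p} {q = q} P zero Q =
    (λ _ → 1#) , (λ z → q z - p z) , Poly-1 , Poly-lead (-‿inverseʳ 1#) (Poly-- Q P) ,
    λ z → solve 2 (λ q p → q := p :* con (+ 1) :+ (q :- p)) refl (q z) (p z)
  Poly-divMod {p = p} {q = q} P (suc e) (cons {p = q′} c Q q≈) with Poly-divMod P e Q
  ... | s , t , S , T , q′≈ with Poly-lower (cons {q = λ z → κ c + z * t z} c T (λ _ → refl))
  ... | a , U =
    (λ z → κ a + z * s z) , (λ z → κ c + z * t z - κ a * p z) ,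
    cons a S (λ _ → refl) ,
    Poly-lead (trans (+-congˡ (-‿cong (*-identityʳ _))) (-‿inverseʳ _)) (Poly-- U (Poly-scale a P)) ,
    λ z → begin
      q z                                                        ≈⟨ q≈ z ⟩
      κ c + z * q′ z                                             ≈⟨ +-congˡ (*-congˡ (q′≈ z)) ⟩
      κ c + z * (p z * s z + t z)
        ≈⟨ solve 6 (λ c z p s t a → c :+ z :* (p :* s :+ t)
            := p :* (a :+ z :* s) :+ (c :+ z :* t :- a :* p)) refl (κ c) z (p z) (s z) (t z) (κ a) ⟩
      p z * (κ a + z * s z) + (κ c + z * t z - κ a * p z)        ∎

  -- Vanishing leading coefficients are stripped until an invertible one is met, which then scales
  -- the polynomial to a monic one. This lets a nonzero remainder compete with a minimal polynomial,
  -- which is monic by definition.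
  Poly-monic⊎zero :
    (∀ a → κ a ≈ 0# ⊎ ∃[ b ] κ b * κ a ≈ 1#) → ∀ d → Poly 0# d p →
    (∀ z → p z ≈ 0#) ⊎ ∃[ e ] ∃[ g ] e ℕ.< d × Poly 1# e g × ∃[ b ] (∀ z → g z ≈ b * p z)
  Poly-monic⊎zero inv zero (const _ _ p≈0) = inj₁ p≈0
  Poly-monic⊎zero inv (suc d) P with Poly-lower P
  ... | a , P′ with inv a
  ... | inj₂ (b , ba≈1) =
    inj₂ (d , _ , ℕ.≤-refl , Poly-lead ba≈1 (Poly-scale b P′) , κ b , λ _ → refl)
  ... | inj₁ a≈0 with Poly-monic⊎zero inv d (Poly-lead a≈0 P′)
  ... | inj₁ p≈0 = inj₁ p≈0
  ... | inj₂ (e , g , e<d , G , g≈) = inj₂ (e , g , ℕ.m≤n⇒m≤1+n e<d , G , g≈)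

  -- For κ = `fromℝ ∘ ι` this unfolds to `monicEval ι`, so results carry over to algebraic integers
  -- and conjugates without conversion.
  monic : ∀ {d} → Vector A.Carrier d → Carrier → Carrier
  monic {d} c z = z ^ d + sum (λ i → κ (c i) * z ^ toℕ i)

  monic-suc : ∀ {d} (c : Vector A.Carrier (suc d)) z →
              monic c z ≈ κ (c zero) + z * monic (tail c) z
  monic-suc {d} c z = begin
    z * z ^ d + (κ (c zero) * 1# + sum (λ i → κ (c (suc i)) * (z * z ^ toℕ i)))
      ≈⟨ +-congˡ (+-congˡ (trans (sum-cong-≋ (λ i → solve 3 (λ c z w → c :* (z :* w)
          := z :* (c :* w)) refl (κ (c (suc i))) z (z ^ toℕ i))) (sym (*-distribˡ-sum {d} z _)))) ⟩
    z * z ^ d + (κ (c zero) * 1# + z * S)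
      ≈⟨ solve 4 (λ z w c s → z :* w :+ (c :* con (+ 1) :+ z :* s)
          := c :+ z :* (w :+ s)) refl z (z ^ d) (κ (c zero)) S ⟩
    κ (c zero) + z * (z ^ d + S) ∎
    where S = sum (λ i → κ (c (suc i)) * z ^ toℕ i)

  Poly-monic : ∀ {d} (c : Vector A.Carrier d) → Poly 1# d (monic c)
  Poly-monic {zero}  c = Poly-resp (λ _ → +-identityʳ 1#) Poly-1
  Poly-monic {suc d} c = cons (c zero) (Poly-monic (tail c)) (monic-suc c)

  Poly⇒monic : Poly 1# d p → ∃[ c ] (∀ z → p z ≈ monic {d} c z)
  Poly⇒monic (const a κa≈1 p≈1) = [] , λ z → trans (p≈1 z) (sym (+-identityʳ 1#))
  Poly⇒monic (cons a P p≈) with Poly⇒monic P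
  ... | c , p′≈ = (a ∷ c) , λ z → trans (p≈ z) (trans (+-congˡ (*-congˡ (p′≈ z))) (sym (monic-suc (a ∷ c) z)))

  Poly-· : ∀ n → Poly (n · 1#) 0 (λ _ → n · 1#)
  Poly-· zero    = const A.0# κ.0#-homo (λ _ → refl)
  Poly-· (suc n) = Poly-+ Poly-1 (Poly-· n)

  module _ {n} (a : Vector ℕ (suc n)) (2≤a : ∀ i → 2 ℕ.≤ a i) where
    private
      open RawSemiringDefinitions ℕ.+-*-rawSemiring using () renaming (sum to sumℕ)
      open import Algebra.Properties.CommutativeMonoid.Sum ℕ.+-0-commutativeMonoid using () renaming (sum-remove to sumℕ-remove)

      D : Vector (Carrier → Carrier) (suc n)
      D i z = z ^ a i - 1#

      Poly-^-1′ : ∀ {m} → 1 ℕ.≤ m → Poly 1# m (λ z → z ^ m - 1#)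
      Poly-^-1′ {suc m} _ = Poly-^-1 m

      degree : ∀ i → suc (a i ℕ.∸ 1 ℕ.+ sumℕ (removeAt a i)) ≡ sumℕ a
      degree i = ≡.trans (≡.cong (ℕ._+ sumℕ (removeAt a i)) (ℕ.m+[n∸m]≡n (ℕ.≤-trans (s≤s z≤n) (2≤a i))))
                         (≡.sym (sumℕ-remove {n} {i} a))

      T : Vector (Carrier → Carrier) (suc n)
      T i z = (z ^ (a i ℕ.∸ 1) - 1#) * product (removeAt (λ j → z ^ a j - 1#) i)

      Poly-T : ∀ i → Poly 0# (sumℕ a) (T i)
      Poly-T i = ≡.subst (λ d → Poly 0# d (T i)) (degree i)
        (Poly-raise (Poly-lead (*-identityˡ 1#) (Poly-* (Poly-^-1′ (ℕ.∸-monoˡ-≤ 1 (2≤a i)))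
          (Poly-product (removeAt a i) (removeAt D i) (λ j → Poly-^-1′ (ℕ.≤-trans (s≤s z≤n) (2≤a _)))))))

    -- Each summand `T i` falls one degree short of the full product, so after multiplication by z
    -- the sum still has coefficient zero in degree `suc (sumℕ a)`, and the leading term is that of
    -- z ∏ (z^{aᵢ} - 1). Over ℤ this makes θ an algebraic integer, over ℚ it makes the minimal
    -- polynomial of θ divide `Q`.
    Poly-Q : ∀ r k → Poly 1# (suc (sumℕ a)) (λ z →
      (z + 1# - r · 1# + k · 1#) * product (λ i → z ^ a i - 1#)
      - z * sum (λ i → (z ^ (a i ℕ.∸ 1) - 1#) * product (removeAt (λ j → z ^ a j - 1#) i)))
    Poly-Q r k = Poly-lead (solve 0 (con (+ 1) :* con (+ 1) :- con (+ 0) := con (+ 1)) refl) (Poly--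
      (Poly-* linear (Poly-product a D (λ i → Poly-^-1′ (ℕ.≤-trans (s≤s z≤n) (2≤a i)))))
      (Poly-shift (Poly-sum T Poly-T)))
      where
      linear : Poly 1# 1 (λ z → z + 1# - r · 1# + k · 1#)
      linear = Poly-lead (+-identityʳ 1#) (Poly-resp
        (λ z → solve 3 (λ z r k → z :+ con (+ 1) :- r :+ k
            := z :* con (+ 1) :+ (con (+ 1) :- r :+ k)) refl z (r · 1#) (k · 1#))
        (Poly-+ (Poly-^ 1) (Poly-raise (Poly-+ (Poly-- Poly-1 (Poly-· r)) (Poly-· k)))))

  module MinimalPolynomials
    (em : ExcludedMiddle 0ℓ)
    (κ-inverse : ∀ a → κ a ≈ 0# ⊎ ∃[ b ] κ b * κ a ≈ 1#)
    (1≉0 : ¬ 1# ≈ 0#)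
    (*-zeroʳ⇒ : ∀ {x y} → ¬ x ≈ 0# → x * y ≈ 0# → y ≈ 0#)
    where

    private variable
      z w : Carrier

    Vanishing : ℕ → Carrier → Set
    Vanishing d z = ∃[ c ] monic {d} c z ≈ 0#

    IsMinimal : ∀ {d} → Vector A.Carrier d → Carrier → Set
    IsMinimal {d} c z = monic c z ≈ 0# × (∀ {e} (c′ : Vector A.Carrier e) → monic c′ z ≈ 0# → d ℕ.≤ e)

    minimalPolynomial : ∀ {d} → Vanishing d z → ∃[ e ] ∃[ c ] IsMinimal {e} c z
    minimalPolynomial {z} {d} = search d d ℕ.≤-refl
      where
      -- The recursion is on `bound`, since `d` may drop by more than one at a time; excluded middle
      -- decides whether a smaller degree occurs at all.
      search : ∀ bound d → d ℕ.≤ bound → Vanishing d z → ∃[ e ] ∃[ c ] IsMinimal {e} c z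
      search bound d d≤bound (c , c-root) with em {∃[ e ] e ℕ.< d × Vanishing e z}
      ... | no minimal = d , c , c-root , λ {e} c′ c′-root → ℕ.≮⇒≥ λ e<d → minimal (e , e<d , c′ , c′-root)
      search zero zero d≤bound _ | yes (_ , () , _)
      search (suc bound) d d≤bound _ | yes (e , e<d , e-root) =
        search bound e (ℕ.≤-pred (ℕ.≤-trans e<d d≤bound)) e-root

    root⇒Vanishing : Poly 1# d p → p z ≈ 0# → Vanishing d z
    root⇒Vanishing {z = z} P pz≈0 with Poly⇒monic P
    ... | c , p≈ = c , trans (sym (p≈ z)) pz≈0

    -- The remainder vanishes at `z`; unless it is zero everywhere, a multiple of it is monic of
    -- degree below `d`, against minimality. The cofactor comes with its degree because
    -- `conjugate-root` compares degrees.
    minimal-∣ : ∀ {d} {c : Vector A.Carrier d} → IsMinimal c z → ∀ {e g} → Poly 1# e g → g z ≈ 0# →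
                d ℕ.≤ e × ∃[ s ] Poly 1# (e ℕ.∸ d) s × (∀ u → g u ≈ monic c u * s u)
    minimal-∣ {z} {d} {c} (c-root , minimal) {e} {g} G gz≈0 =
      d≤e , s , S , λ u → trans (g≈ u) (trans (+-congˡ (t≈0 u)) (+-identityʳ _))
      where
      vanishing = root⇒Vanishing G gz≈0
      d≤e : d ℕ.≤ e
      d≤e = minimal (proj₁ vanishing) (proj₂ vanishing)
      division = Poly-divMod (Poly-monic c) (e ℕ.∸ d) (≡.subst (λ k → Poly 1# k g) (≡.sym (ℕ.m∸n+n≡m d≤e)) G)
      s = proj₁ division
      t = proj₁ (proj₂ division)
      S = proj₁ (proj₂ (proj₂ division))
      T = proj₁ (proj₂ (proj₂ (proj₂ division)))
      g≈ : ∀ u → g u ≈ monic c u * s u + t u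
      g≈ = proj₂ (proj₂ (proj₂ (proj₂ division)))
      tz≈0 : t z ≈ 0#
      tz≈0 = begin
        t z                      ≈⟨ +-identityˡ (t z) ⟨
        0# + t z                 ≈⟨ +-congʳ (zeroˡ (s z)) ⟨
        0# * s z + t z           ≈⟨ +-congʳ (*-congʳ c-root) ⟨
        monic c z * s z + t z    ≈⟨ g≈ z ⟨
        g z                      ≈⟨ gz≈0 ⟩
        0#                       ∎
      t≈0 : ∀ u → t u ≈ 0#
      t≈0 with Poly-monic⊎zero κ-inverse d T
      ... | inj₁ t≈0 = t≈0
      ... | inj₂ (e′ , g′ , e′<d , G′ , b , g′≈) = contradiction
        (let c′ , root = root⇒Vanishing G′ (trans (g′≈ z) (trans (*-congˡ tz≈0) (zeroʳ b)))
         in minimal c′ root)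
        (ℕ.<⇒≱ e′<d)

    -- The minimal polynomial of z is the product of that of its root w and a
    -- cofactor, which cannot vanish at z by minimality.
    conjugate-root : ∀ {d} {c : Vector A.Carrier d} → IsMinimal c z → monic c w ≈ 0# →
                     ∀ {e g} → Poly 1# e g → g w ≈ 0# → g z ≈ 0#
    conjugate-root {z} {w} {d} {c} (c-root , minimal) cw≈0 {e} {g} G gw≈0
      with minimalPolynomial (c , cw≈0)
    ... | dʷ , cʷ , cʷ-minimal
      with minimal-∣ cʷ-minimal (Poly-monic c) cw≈0 | minimal-∣ cʷ-minimal G gw≈0
    ... | dʷ≤d , s , S , c≈ | _ , s′ , _ , g≈ =
      trans (g≈ z) (trans (*-congʳ cʷz≈0) (zeroˡ (s′ z)))
      where
      degree≢0 : ∀ {k} (c : Vector A.Carrier k) → k ≡ 0 → ¬ monic c w ≈ 0#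
      degree≢0 c ≡.refl root = 1≉0 (trans (sym (+-identityʳ 1#)) root)
      sz≉0 : ¬ s z ≈ 0#
      sz≉0 sz≈0 = degree≢0 cʷ (ℕ.n≤0⇒n≡0 (ℕ.+-cancelˡ-≤ d dʷ 0 d+dʷ≤d)) (proj₁ cʷ-minimal)
        where
        cofactor = root⇒Vanishing S sz≈0
        d+dʷ≤d : d ℕ.+ dʷ ℕ.≤ d ℕ.+ 0
        d+dʷ≤d = ℕ.≤-trans (ℕ.+-monoˡ-≤ dʷ (minimal (proj₁ cofactor) (proj₂ cofactor)))
          (ℕ.≤-reflexive (≡.trans (ℕ.m∸n+n≡m dʷ≤d) (≡.sym (ℕ.+-identityʳ d))))
      cʷz≈0 : monic cʷ z ≈ 0#
      cʷz≈0 = *-zeroʳ⇒ sz≉0 (trans (*-comm (s z) (monic cʷ z)) (trans (sym (c≈ z)) c-root))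

-- Order, suprema and square roots in a complete ordered field.

module RealAnalysis (ℝ : CompleteOrderedField) where
  open CompleteOrderedField ℝ hiding (zero)
  open RealAndComplex ℝ using (≮⇒≥; √)
  open IntegerSolver commutativeRing
  open RawSemiringDefinitions (Semiring.rawSemiring semiring) using () renaming (_×_ to _·_)
  open import Relation.Binary.Reasoning.Setoid setoid
  module < = IsStrictTotalOrder isStrictTotalOrder
  module ≤ = IsPartialOrder (StrictToNonStrict.isPartialOrder _≈_ _<_ <.isStrictPartialOrder)

  private variable
    x y z c e : Carrier

  <-≤-trans : x < y → y ≤ z → x < z
  <-≤-trans x<y (inj₁ y<z) = <.trans x<y y<z
  <-≤-trans x<y (inj₂ y≈z) = <.<-respʳ-≈ y≈z x<y

  ≤-<-trans : x ≤ y → y < z → x < z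
  ≤-<-trans (inj₁ x<y) y<z = <.trans x<y y<z
  ≤-<-trans (inj₂ x≈y) y<z = <.<-respˡ-≈ (sym x≈y) y<z

  <-irrefl : ¬ x < x
  <-irrefl = <.irrefl refl

  <⇒≱ : x < y → ¬ y ≤ x
  <⇒≱ x<y y≤x = <-irrefl (<-≤-trans x<y y≤x)

  ≰⇒> : ¬ x ≤ y → y < x
  ≰⇒> {x} {y} x≰y with <.compare x y
  ... | tri< x<y _ _ = contradiction (inj₁ x<y) x≰y
  ... | tri≈ _ x≈y _ = contradiction (inj₂ x≈y) x≰y
  ... | tri> _ _ y<x = y<x

  0<⇒≉0 : 0# < x → ¬ x ≈ 0#
  0<⇒≉0 0<x x≈0 = <.irrefl (sym x≈0) 0<x

  <⇒0<- : x < y → 0# < y - x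
  <⇒0<- {x} {y} x<y = <.<-respˡ-≈ (-‿inverseˡ x) (<.<-respʳ-≈ (+-comm (- x) y) (+-monoʳ-< (- x) x<y))

  -- The working form of most inequalities below: the ring solver rewrites the difference as an
  -- expression `e` whose positivity can be read off.
  0<-⇒< : 0# < e → y - x ≈ e → x < y
  0<-⇒< {e} {y} {x} 0<e y-x≈e = <.<-respˡ-≈ (+-identityʳ x) (<.<-respʳ-≈
    (trans (+-congˡ (sym y-x≈e)) (solve 2 (λ x y → x :+ (y :- x) := y) refl x y)) (+-monoʳ-< x 0<e))

  ≤⇒0≤- : x ≤ y → 0# ≤ y - x
  ≤⇒0≤- (inj₁ x<y)         = inj₁ (<⇒0<- x<y)
  ≤⇒0≤- {x} (inj₂ x≈y) = inj₂ (sym (trans (+-congʳ (sym x≈y)) (-‿inverseʳ x)))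

  0≤-⇒≤ : 0# ≤ e → y - x ≈ e → x ≤ y
  0≤-⇒≤ (inj₁ 0<e) y-x≈e = inj₁ (0<-⇒< 0<e y-x≈e)
  0≤-⇒≤ {e} {y} {x} (inj₂ 0≈e) y-x≈e = inj₂ (begin
    x             ≈⟨ +-identityʳ x ⟨
    x + 0#        ≈⟨ +-congˡ (trans 0≈e (sym y-x≈e)) ⟩
    x + (y - x)   ≈⟨ solve 2 (λ x y → x :+ (y :- x) := y) refl x y ⟩
    y             ∎)

  0<+≤ : 0# < x → 0# ≤ y → 0# < x + y
  0<+≤ {x} 0<x (inj₁ 0<y) = <.trans 0<x (<.<-respˡ-≈ (+-identityʳ x) (+-monoʳ-< x 0<y))
  0<+≤ {x} 0<x (inj₂ 0≈y) = <.<-respʳ-≈ (trans (sym (+-identityʳ x)) (+-congˡ 0≈y)) 0<x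

  0≤+< : 0# ≤ x → 0# < y → 0# < x + y
  0≤+< 0≤x 0<y = <.<-respʳ-≈ (+-comm _ _) (0<+≤ 0<y 0≤x)

  0≤+≤ : 0# ≤ x → 0# ≤ y → 0# ≤ x + y
  0≤+≤ (inj₁ 0<x) 0≤y = inj₁ (0<+≤ 0<x 0≤y)
  0≤+≤ (inj₂ 0≈x) 0≤y = ≤.trans 0≤y (inj₂ (trans (sym (+-identityˡ _)) (+-congʳ 0≈x)))

  0≤*≤ : 0# ≤ x → 0# ≤ y → 0# ≤ x * y
  0≤*≤ (inj₁ 0<x) (inj₁ 0<y) = inj₁ (*-pos 0<x 0<y)
  0≤*≤ {x} {y} (inj₂ 0≈x) _ = inj₂ (trans (sym (zeroˡ y)) (*-congʳ 0≈x))
  0≤*≤ {x} {y} _ (inj₂ 0≈y) = inj₂ (trans (sym (zeroʳ x)) (*-congˡ 0≈y))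

  <0⇒0<- : x < 0# → 0# < - x
  <0⇒0<- x<0 = <.<-respʳ-≈ (+-identityˡ _) (<⇒0<- x<0)

  x≉0⇒0<x² : ¬ x ≈ 0# → 0# < x * x
  x≉0⇒0<x² {x} x≉0 with <.compare 0# x
  ... | tri< 0<x _ _ = *-pos 0<x 0<x
  ... | tri≈ _ 0≈x _ = contradiction (sym 0≈x) x≉0
  ... | tri> _ _ x<0 = <.<-respʳ-≈ (solve 1 (λ x → :- x :* :- x := x :* x) refl x)
                         (*-pos (<0⇒0<- x<0) (<0⇒0<- x<0))

  0≤x² : ∀ x → 0# ≤ x * x
  0≤x² x with x <.≟ 0#
  ... | yes x≈0 = inj₂ (sym (trans (*-congʳ x≈0) (zeroˡ x)))
  ... | no x≉0  = inj₁ (x≉0⇒0<x² x≉0)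

  0<*⇒0< : 0# < c → 0# < c * x → 0# < x
  0<*⇒0< {c} {x} 0<c 0<cx with <.compare 0# x
  ... | tri< 0<x _ _ = 0<x
  ... | tri≈ _ 0≈x _ = contradiction (trans (*-congˡ (sym 0≈x)) (zeroʳ c)) (0<⇒≉0 0<cx)
  ... | tri> _ _ x<0 = contradiction
    (<.<-respʳ-≈ (solve 2 (λ c x → c :* x :+ c :* :- x := con (+ 0)) refl c x)
      (0<+≤ 0<cx (inj₁ (*-pos 0<c (<0⇒0<- x<0))))) <-irrefl

  0≤*⇒0≤ : 0# < c → 0# ≤ c * x → 0# ≤ x
  0≤*⇒0≤ {c} {x} 0<c 0≤cx = ≮⇒≥ λ x<0 → <⇒≱ (*-pos 0<c (<0⇒0<- x<0))
    (0≤-⇒≤ 0≤cx (solve 2 (λ c x → con (+ 0) :- c :* :- x := c :* x) refl c x))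

  0<⇒0<⁻¹ : 0# < x → 0# < x ⁻¹
  0<⇒0<⁻¹ {x} 0<x = 0<*⇒0< 0<x (<.<-respʳ-≈ (sym (⁻¹-inverseʳ x (0<⇒≉0 0<x))) 0<1)

  0<2 : 0# < 1# + 1#
  0<2 = 0<+≤ 0<1 (inj₁ 0<1)

  dense : x < y → ∃[ z ] x < z × z < y
  dense {x} {y} x<y = x + h , 0<-⇒< 0<h (solve 2 (λ x h → x :+ h :- x := h) refl x h) , 0<-⇒< 0<h eq
    where
    ½ = (1# + 1#) ⁻¹
    h = (y - x) * ½
    0<h : 0# < h
    0<h = *-pos (<⇒0<- x<y) (0<⇒0<⁻¹ 0<2)
    eq : y - (x + h) ≈ h
    eq = begin
      y - (x + h)
        ≈⟨ +-congʳ (trans (solve 2 (λ x y → y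
            := x :+ (y :- x) :* con (+ 1)) refl x y) (+-congˡ (*-congˡ (sym (⁻¹-inverseʳ _ (0<⇒≉0 0<2)))))) ⟩
      x + (y - x) * ((1# + 1#) * ½) - (x + h)
        ≈⟨ solve 3 (λ x y h → x :+ (y :- x) :* (con (+ 2) :* h) :- (x :+ (y :- x) :* h)
            := (y :- x) :* h) refl x y ½ ⟩
      h                                 ∎

  dense₂ : ∀ {a b c} → a < b → a < c → ∃[ z ] a < z × z < b × z < c
  dense₂ {a} {b} {c} a<b a<c with <.compare b c
  ... | tri< b<c _ _ = let z , a<z , z<b = dense a<b in z , a<z , z<b , <.trans z<b b<c
  ... | tri≈ _ b≈c _ = let z , a<z , z<b = dense a<b in z , a<z , z<b , <.<-respʳ-≈ b≈c z<b
  ... | tri> _ _ c<b = let z , a<z , z<c = dense a<c in z , a<z , <.trans z<c c<b , z<c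

  -- The condition forbids upward jumps, which is all of continuity that the
  -- supremum argument needs.
  intermediate-value : (q : Carrier → Carrier) → ∀ {a b} → a < b → q a < 0# → 0# < q b →
    (∀ {x y} → a ≤ x → x ≤ y → q y - q x ≤ y - x) →
    ∃[ s ] a < s × s < b × q s ≈ 0#
  intermediate-value q {a} {b} a<b qa<0 0<qb jump = s , a<s , s<b , qs≈0
    where
    S : Carrier → Set
    S x = a ≤ x × x ≤ b × q x < 0#
    sup = complete S (a , inj₂ refl , inj₁ a<b , qa<0) (b , λ (_ , x≤b , _) → x≤b)
    s = proj₁ sup
    a≤s : a ≤ s
    a≤s = proj₁ (proj₂ sup) (inj₂ refl , inj₁ a<b , qa<0)
    s≤b : s ≤ b
    s≤b = proj₂ (proj₂ sup) (λ (_ , x≤b , _) → x≤b)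
    rise : ∀ {x y} → a ≤ x → x ≤ y → q y ≤ q x + (y - x)
    rise {x} {y} a≤x x≤y = 0≤-⇒≤ (≤⇒0≤- (jump a≤x x≤y))
      (solve 4 (λ x y p q → p :+ (y :- x) :- q := y :- x :- (q :- p)) refl x y (q x) (q y))
    q-cong : ∀ {x y} → a ≤ x → x ≈ y → q y ≤ q x
    q-cong {x} {y} a≤x x≈y = ≤.trans (rise a≤x (inj₂ x≈y))
      (inj₂ (trans (+-congˡ (trans (+-congʳ (sym x≈y)) (-‿inverseʳ x))) (+-identityʳ (q x))))
    not-neg : ¬ q s < 0#
    not-neg qs<0 with s≤b
    ... | inj₂ s≈b = <⇒≱ (<.trans qs<0 0<qb) (q-cong a≤s s≈b)
    -- Any `y` above `s` but below both `b` and `s - q s` is still in `S`, because q y ≤ q s + (y -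
    -- s) < 0.
    ... | inj₁ s<b with dense₂ s<b (0<-⇒< (<0⇒0<- qs<0) (solve 2 (λ s q → s :- q :- s := :- q) refl s (q s)))
    ... | y , s<y , y<b , y<s-qs = <⇒≱ s<y (proj₁ (proj₂ sup)
          (≤.trans a≤s (inj₁ s<y) , inj₁ y<b , ≤-<-trans (rise a≤s (inj₁ s<y))
            (0<-⇒< (<⇒0<- y<s-qs) (solve 3 (λ s y q → con (+ 0) :- (q :+ (y :- s))
                := s :- q :- y) refl s y (q s)))))
    -- If q s were positive, `s - q s` would be a smaller upper bound: a point t of `S` beyond it
    -- would satisfy q t ≥ q s - (s - t) > 0.
    not-pos : ¬ 0# < q s
    not-pos 0<qs = <⇒≱ (0<-⇒< 0<qs (solve 2 (λ s q → s :- (s :- q) := q) refl s (q s)))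
      (proj₂ (proj₂ sup) {s - q s} λ {t} t∈S@(a≤t , _ , qt<0) → ≮⇒≥ λ s-qs<t →
        <⇒≱ (<.trans qt<0
               (0<-⇒< (<⇒0<- s-qs<t) (solve 3 (λ s t q → q :- (s :- t) :- con (+ 0)
                   := t :- (s :- q)) refl s t (q s))))
          (0≤-⇒≤ (≤⇒0≤- (rise a≤t (proj₁ (proj₂ sup) t∈S)))
            (solve 4 (λ s t q p → p :- (q :- (s :- t)) := p :+ (s :- t) :- q) refl s t (q s) (q t))))
    qs≈0 : q s ≈ 0#
    qs≈0 = ≤.antisym (≮⇒≥ not-pos) (≮⇒≥ not-neg)
    a<s : a < s
    a<s with a≤s
    ... | inj₁ a<s = a<s
    ... | inj₂ a≈s = contradiction (≤.trans (inj₂ (sym qs≈0)) (q-cong (inj₂ refl) a≈s)) (<⇒≱ qa<0)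
    s<b : s < b
    s<b with s≤b
    ... | inj₁ s<b = s<b
    ... | inj₂ s≈b = contradiction (≤.trans (q-cong a≤s s≈b) (inj₂ qs≈0)) (<⇒≱ 0<qb)

  -- If the multiples of `1#` were bounded, their supremum s would satisfy n + 1 ≤ s for every n,
  -- and s - 1 would already be an upper bound.
  archimedean : ExcludedMiddle 0ℓ → ∀ x → ∃[ n ] x < n · 1#
  archimedean em x with em {∃[ n ] x < n · 1#}
  ... | yes n>x = n>x
  ... | no ∄n = contradiction (proj₂ (proj₂ sup) {s - 1#} below)
                  (<⇒≱ (0<-⇒< 0<1 (solve 1 (λ s → s :- (s :- con (+ 1)) := con (+ 1)) refl s)))
    where
    S : Carrier → Set
    S y = ∃[ n ] y ≈ n · 1#
    sup = complete S (0# , 0 , refl)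
      (x , λ (n , y≈n) → ≤.trans (inj₂ y≈n) (≮⇒≥ λ x<n → ∄n (n , x<n)))
    s = proj₁ sup
    below : IsUpperBound S (s - 1#)
    below {y} (n , y≈n) = 0≤-⇒≤ (≤⇒0≤- (proj₁ (proj₂ sup) {1# + y} (suc n , +-congˡ y≈n)))
      (solve 2 (λ s y → s :- con (+ 1) :- y := s :- (con (+ 1) :+ y)) refl s y)

  *-mono-<-sq : 0# ≤ x → x < y → x * x < y * y
  *-mono-<-sq {x} {y} 0≤x x<y = 0<-⇒< (*-pos (<⇒0<- x<y) (0<+≤ (≤-<-trans 0≤x x<y) 0≤x))
    (solve 2 (λ x y → y :* y :- x :* x := (y :- x) :* (y :+ x)) refl x y)

  sq-cancel-≤ : 0# ≤ y → x * x ≤ y * y → x ≤ y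
  sq-cancel-≤ 0≤y x²≤y² = ≮⇒≥ λ y<x → <⇒≱ (*-mono-<-sq 0≤y y<x) x²≤y²

  sq-cancel-< : 0# ≤ y → x * x < y * y → x < y
  sq-cancel-< 0≤y x²<y² = ≰⇒> λ { (inj₁ y<x) → <-irrefl (<.trans x²<y² (*-mono-<-sq 0≤y y<x))
                                 ; (inj₂ y≈x) → <.irrefl (sym (*-cong y≈x y≈x)) x²<y² }

  module _ {x : Carrier} (0≤x : 0# ≤ x) where
    private
      isLUB = proj₂ (complete (RealAndComplex.SqrtSet ℝ x) (0# , inj₁ (inj₂ refl)) (RealAndComplex.sqrtSet-bounded ℝ x))
      s = √ x

    √-nonneg : 0# ≤ √ x
    √-nonneg = proj₁ isLUB (inj₁ (inj₂ refl))

    √-square : √ x * √ x ≈ x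
    √-square = ≤.antisym (≮⇒≥ not-above) (≮⇒≥ not-below)
      where
      not-above : ¬ x < s * s
      not-above x<s² = <⇒≱ t<s (proj₂ isLUB {t} bound)
        where
        0<s : 0# < s
        0<s = ≰⇒> λ s≤0 → <⇒≱ x<s² (≤.trans (inj₂ (trans (*-cong (≤.antisym s≤0 √-nonneg) (≤.antisym s≤0 √-nonneg)) (zeroˡ 0#))) 0≤x)
        2s = s + s
        0<2s : 0# < 2s
        0<2s = 0<+≤ 0<s (inj₁ 0<s)
        -- The Newton step from `s`: since 2 s t = s² + x, one has t² - x = (s - t)² ≥ 0, so `t` is
        -- an upper bound, and smaller than `s`.
        t = (s * s + x) * 2s ⁻¹
        2st : 2s * t ≈ s * s + x
        2st = begin
          2s * ((s * s + x) * 2s ⁻¹)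
            ≈⟨ solve 3 (λ a b c → a :* (b :* c) := b :* (a :* c)) refl 2s (s * s + x) (2s ⁻¹) ⟩
          (s * s + x) * (2s * 2s ⁻¹)   ≈⟨ *-congˡ (⁻¹-inverseʳ _ (0<⇒≉0 0<2s)) ⟩
          (s * s + x) * 1#             ≈⟨ *-identityʳ _ ⟩
          s * s + x                    ∎
        t<s : t < s
        t<s = 0<-⇒< (0<*⇒0< 0<2s (<.<-respʳ-≈ (sym (begin
          2s * (s - t)
            ≈⟨ solve 2 (λ s t → (s :+ s) :* (s :- t) := s :* s :+ s :* s :- (s :+ s) :* t) refl s t ⟩
          s * s + s * s - 2s * t ≈⟨ +-congˡ (-‿cong 2st) ⟩
          s * s + s * s - (s * s + x) ≈⟨ solve 2 (λ a x → a :+ a :- (a :+ x) := a :- x) refl (s * s) x ⟩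
          s * s - x ∎)) (<⇒0<- x<s²))) refl
        0≤t : 0# ≤ t
        0≤t = 0≤*⇒0≤ 0<2s (≤.trans (0≤+≤ (0≤x² s) 0≤x) (inj₂ (sym 2st)))
        x≤t² : x ≤ t * t
        x≤t² = 0≤-⇒≤ (0≤x² (s - t)) (begin
          t * t - x
            ≈⟨ solve 3 (λ s t x → t :* t :- x := s :* s :+ t :* t :- (s :* s :+ x)) refl s t x ⟩
          s * s + t * t - (s * s + x)        ≈⟨ +-congˡ (-‿cong (sym 2st)) ⟩
          s * s + t * t - 2s * t
            ≈⟨ solve 2 (λ s t → s :* s :+ t :* t :- (s :+ s) :* t := (s :- t) :* (s :- t)) refl s t ⟩
          (s - t) * (s - t)                  ∎)
        bound : IsUpperBound (RealAndComplex.SqrtSet ℝ x) t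
        bound (inj₁ u≤0)  = ≤.trans u≤0 0≤t
        bound (inj₂ u²≤x) = sq-cancel-≤ 0≤t (≤.trans u²≤x x≤t²)
      not-below : ¬ s * s < x
      not-below s²<x = <⇒≱ s<t (proj₁ isLUB (inj₂ t²≤x))
        where
        -- `M` exceeds 2 s by 1 + x so that x - (s + d)² = M d - 2 s d - d² = d (1 + x - d). The
        -- right side is positive once d < 1 + x, which the size of `M` guarantees as well.
        M = s + s + 1# + x
        0<M : 0# < M
        0<M = 0<+≤ (0≤+< (0≤+≤ √-nonneg √-nonneg) 0<1) 0≤x
        0<x-s² : 0# < x - s * s
        0<x-s² = <⇒0<- s²<x
        d = (x - s * s) * M ⁻¹
        0<d : 0# < d
        0<d = *-pos 0<x-s² (0<⇒0<⁻¹ 0<M)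
        Md : M * d ≈ x - s * s
        Md = begin
          M * ((x - s * s) * M ⁻¹)
            ≈⟨ solve 3 (λ a b c → a :* (b :* c) := b :* (a :* c)) refl M (x - s * s) (M ⁻¹) ⟩
          (x - s * s) * (M * M ⁻¹)   ≈⟨ *-congˡ (⁻¹-inverseʳ _ (0<⇒≉0 0<M)) ⟩
          (x - s * s) * 1#           ≈⟨ *-identityʳ _ ⟩
          x - s * s                  ∎
        t = s + d
        s<t : s < t
        s<t = 0<-⇒< 0<d (solve 2 (λ s d → s :+ d :- s := d) refl s d)
        d<M : d < 1# + x
        d<M = 0<-⇒< (0<*⇒0< 0<M (<.<-respʳ-≈ (sym (begin
            M * (1# + x - d)
              ≈⟨ solve 3 (λ m x d → m :* (con (+ 1) :+ x :- d)
                  := m :* (con (+ 1) :+ x) :- m :* d) refl M x d ⟩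
            M * (1# + x) - M * d        ≈⟨ +-congˡ (-‿cong Md) ⟩
            M * (1# + x) - (x - s * s)
              ≈⟨ solve 2 (λ s x → (s :+ s :+ con (+ 1) :+ x) :* (con (+ 1) :+ x) :- (x :- s :* s)
                   := con (+ 1) :+ ((s :+ s) :* (con (+ 1) :+ x) :+ x :+ x :* x :+ s :* s)) refl s x ⟩
            1# + ((s + s) * (1# + x) + x + x * x + s * s)   ∎))
            (0<+≤ 0<1 (0≤+≤ (0≤+≤ (0≤+≤ (0≤*≤ (0≤+≤ √-nonneg √-nonneg) (0≤+≤ (inj₁ 0<1) 0≤x)) 0≤x) (0≤x² x)) (0≤x² s))))) refl
        t²≤x : t * t ≤ x
        t²≤x = inj₁ (0<-⇒< (*-pos 0<d (<⇒0<- d<M)) (begin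
          x - (s + d) * (s + d)
            ≈⟨ solve 3 (λ s d x → x :- (s :+ d) :* (s :+ d)
                := x :- s :* s :- (d :* (s :+ s) :+ d :* d)) refl s d x ⟩
          x - s * s - (d * (s + s) + d * d)      ≈⟨ +-congʳ (sym Md) ⟩
          M * d - (d * (s + s) + d * d)
            ≈⟨ solve 3 (λ s d x → (s :+ s :+ con (+ 1) :+ x) :* d :- (d :* (s :+ s) :+ d :* d)
                := d :* (con (+ 1) :+ x :- d)) refl s d x ⟩
          d * (1# + x - d)                       ∎))

-- Arms and the function `star` on the half-line x ≥ 1.

module RealArms (ℝ : CompleteOrderedField) where
  open CompleteOrderedField ℝ hiding (zero)
  open IntegerSolver commutativeRing
  open RealAnalysis ℝ
  open RawSemiringDefinitions (Semiring.rawSemiring semiring) using (sum; _^_) renaming (_×_ to _·_)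
  open import Algebra.Properties.Semiring.Sum semiring
    using (*-distribʳ-sum; *-distribˡ-sum; sum-replicate; sum-replicate-zero)
  open import Relation.Binary.Reasoning.Setoid setoid

  -- arm b x is (xᵃ - x) / (xᵃ - 1) for a = 1 + b and x > 1.
  arm : ℕ → Carrier → Carrier
  arm zero    x = 0#
  arm (suc b) x = x * (x + 1# - arm b x) ⁻¹

  module _ {x : Carrier} (1≤x : 1# ≤ x) where

    0<x : 0# < x
    0<x = <-≤-trans 0<1 1≤x

    -- Multiplying the gap `1# - arm (suc b) x` by the denominator D = x + 1 - f_b gives D - x,
    -- which is the previous gap. Positivity of D in turn follows from the bound for `b`, hence the
    -- mutual induction.
    arm<1 : ∀ b → arm b x < 1#
    0<denominator : ∀ b → 0# < x + 1# - arm b x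
    arm-suc : ∀ b → arm (suc b) x * (x + 1# - arm b x) ≈ x

    0<denominator b = <.<-respʳ-≈ (sym (+-assoc x 1# (- arm b x))) (0<+≤ 0<x (inj₁ (<⇒0<- (arm<1 b))))

    arm-suc b = begin
      x * D ⁻¹ * D     ≈⟨ solve 3 (λ x i d → x :* i :* d := x :* (d :* i)) refl x (D ⁻¹) D ⟩
      x * (D * D ⁻¹)   ≈⟨ *-congˡ (⁻¹-inverseʳ D (0<⇒≉0 (0<denominator b))) ⟩
      x * 1#           ≈⟨ *-identityʳ x ⟩
      x                ∎
      where D = x + 1# - arm b x

    arm<1 zero    = 0<1
    arm<1 (suc b) = 0<-⇒< (0<*⇒0< (0<denominator b) (<.<-respʳ-≈ (sym (begin
      D * (1# - arm (suc b) x)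
        ≈⟨ solve 2 (λ d f → d :* (con (+ 1) :- f) := d :- f :* d) refl D (arm (suc b) x) ⟩
      D - arm (suc b) x * D      ≈⟨ +-congˡ (-‿cong (arm-suc b)) ⟩
      x + 1# - arm b x - x
        ≈⟨ solve 2 (λ x f → x :+ con (+ 1) :- f :- x := con (+ 1) :- f) refl x (arm b x) ⟩
      1# - arm b x               ∎)) (<⇒0<- (arm<1 b)))) refl
      where D = x + 1# - arm b x

    0≤arm : ∀ b → 0# ≤ arm b x
    0≤arm zero    = inj₂ refl
    0≤arm (suc b) = inj₁ (*-pos 0<x (0<⇒0<⁻¹ (0<denominator b)))

    -- The bound 1 - f_a ≤ 1/a without a division; it is an equality at x = 1. Multiplied by the
    -- denominator, the step for n + 1 becomes n (1 - f) ≤ x, which follows from the bound for n and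
    -- 1 ≤ x.
    suc-*-gap≤1 : ∀ b → (suc b · 1#) * (1# - arm b x) ≤ 1#
    suc-*-gap≤1 zero    = inj₂ (solve 0 ((con (+ 1) :+ con (+ 0)) :* (con (+ 1) :- con (+ 0))
        := con (+ 1)) refl)
    suc-*-gap≤1 (suc b) = 0≤-⇒≤ (0≤*⇒0≤ (0<denominator b) (≤.trans
      (≤⇒0≤- (≤.trans (suc-*-gap≤1 b) 1≤x)) (inj₂ (sym (begin
        D * (1# - (1# + n) * (1# - f′))
          ≈⟨ solve 3 (λ d n f → d :* (con (+ 1) :- (con (+ 1) :+ n) :* (con (+ 1) :- f))
              := d :- (con (+ 1) :+ n) :* (d :- f :* d)) refl D n f′ ⟩
        D - (1# + n) * (D - f′ * D)
          ≈⟨ +-congˡ (-‿cong (*-congˡ (+-congˡ (-‿cong (arm-suc b))))) ⟩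
        D - (1# + n) * (D - x)
          ≈⟨ solve 3 (λ x n f → x :+ con (+ 1) :- f :- (con (+ 1) :+ n) :* (x :+ con (+ 1) :- f :- x)
              := x :- n :* (con (+ 1) :- f)) refl x n (arm b x) ⟩
        x - n * (1# - arm b x)                   ∎))))) refl
      where
      D = x + 1# - arm b x
      n = suc b · 1#
      f′ = arm (suc b) x

  0≤· : ∀ n → 0# ≤ n · 1#
  0≤· zero    = inj₂ refl
  0≤· (suc n) = 0≤+≤ (inj₁ 0<1) (0≤· n)

  ·-mono : ∀ {m n} → m ℕ.≤ n → m · 1# ≤ n · 1#
  ·-mono {n = n} z≤n   = 0≤· n
  ·-mono {suc m} {suc n} (s≤s m≤n) = 0≤-⇒≤ (≤⇒0≤- (·-mono m≤n))
    (solve 2 (λ m n → con (+ 1) :+ n :- (con (+ 1) :+ m) := n :- m) refl (m · 1#) (n · 1#))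

  n*gap≤1 : ∀ {x b n} → 1# ≤ x → n ℕ.≤ suc b → (n · 1#) * (1# - arm b x) ≤ 1#
  n*gap≤1 {x} {b} {n} 1≤x n≤1+b = ≤.trans
    (0≤-⇒≤ (0≤*≤ (≤⇒0≤- (·-mono n≤1+b)) (≤⇒0≤- (inj₁ (arm<1 1≤x b))))
      (solve 3 (λ m n e → m :* e :- n :* e := (m :- n) :* e) refl (suc b · 1#) (n · 1#) (1# - arm b x)))
    (suc-*-gap≤1 1≤x b)

  arm-mono : ∀ {x y} → 1# ≤ x → x ≤ y → ∀ b → arm b x ≤ arm b y
  arm-mono 1≤x x≤y zero = inj₂ refl
  arm-mono {x} {y} 1≤x x≤y (suc b) = 0≤-⇒≤ (0≤*⇒0≤ (*-pos (0<denominator 1≤x b) (0<denominator 1≤y b))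
    (≤.trans (0≤+≤ (0≤*≤ (≤⇒0≤- x≤y) (≤⇒0≤- (inj₁ (arm<1 1≤x b))))
                   (0≤*≤ (inj₁ (0<x 1≤x)) (≤⇒0≤- (arm-mono 1≤x x≤y b))))
      (inj₂ (sym (begin
        Dx * Dy * (g′ - f′)
          ≈⟨ solve 4 (λ a b f g → a :* b :* (g :- f) := g :* b :* a :- f :* a :* b) refl Dx Dy f′ g′ ⟩
        g′ * Dy * Dx - f′ * Dx * Dy
          ≈⟨ +-cong (*-congʳ (arm-suc 1≤y b)) (-‿cong (*-congʳ (arm-suc 1≤x b))) ⟩
        y * Dx - x * Dy
          ≈⟨ solve 4 (λ x y f g → y :* (x :+ con (+ 1) :- f) :- x :* (y :+ con (+ 1) :- g)
              := (y :- x) :* (con (+ 1) :- f) :+ x :* (g :- f)) refl x y (arm b x) (arm b y) ⟩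
        (y - x) * (1# - arm b x) + x * (arm b y - arm b x) ∎))))) refl
    where
    1≤y = ≤.trans 1≤x x≤y
    Dx = x + 1# - arm b x
    Dy = y + 1# - arm b y
    f′ = arm (suc b) x
    g′ = arm (suc b) y

  -- Cross-multiplied monotonicity of f/(x + 1). After multiplication by both denominators, the
  -- further factor `x + 1#` lets the previous difference `f * (y + 1#) - g * (x + 1#)` reappear,
  -- and the induction step gains the summand `(y - x) * (x * y - 1#) * Dx`, positive because x y >
  -- 1. The arm for a = 1 is identically zero, so strictness begins at `suc b`.
  arm/-anti : ∀ {x y} → 1# ≤ x → x < y → ∀ b → arm b y * (x + 1#) ≤ arm b x * (y + 1#)
  arm/-anti-strict : ∀ {x y} → 1# ≤ x → x < y → ∀ b → arm (suc b) y * (x + 1#) < arm (suc b) x * (y + 1#)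

  arm/-anti 1≤x x<y zero    = inj₂ (trans (zeroˡ _) (sym (zeroˡ _)))
  arm/-anti 1≤x x<y (suc b) = inj₁ (arm/-anti-strict 1≤x x<y b)

  arm/-anti-strict {x} {y} 1≤x x<y b =
    0<-⇒< (0<*⇒0< (0<+≤ (0<x 1≤x) (inj₁ 0<1)) (0<*⇒0< (*-pos (0<denominator 1≤x b) (0<denominator 1≤y b))
      (<.<-respʳ-≈ (sym eq)
        (0<+≤ (*-pos (*-pos (<⇒0<- x<y) 0<xy-1) (0<denominator 1≤x b))
              (0≤*≤ (0≤*≤ (inj₁ (0<x 1≤x)) (0≤+≤ (inj₁ (0<x 1≤y)) (inj₁ 0<1)))
                    (≤⇒0≤- (arm/-anti 1≤x x<y b))))))) refl
    where
    1≤y = ≤.trans 1≤x (inj₁ x<y)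
    Dx = x + 1# - arm b x
    Dy = y + 1# - arm b y
    f = arm b x
    g = arm b y
    f′ = arm (suc b) x
    g′ = arm (suc b) y
    0<xy-1 : 0# < x * y - 1#
    0<xy-1 = <.<-respʳ-≈ (solve 2 (λ x y → (x :- con (+ 1)) :* y :+ (y :- con (+ 1))
        := x :* y :- con (+ 1)) refl x y)
      (0≤+< (0≤*≤ (≤⇒0≤- 1≤x) (inj₁ (0<x 1≤y))) (<⇒0<- (≤-<-trans 1≤x x<y)))
    eq : Dx * Dy * ((x + 1#) * (f′ * (y + 1#) - g′ * (x + 1#)))
         ≈ (y - x) * (x * y - 1#) * Dx + x * (y + 1#) * (f * (y + 1#) - g * (x + 1#))
    eq = begin
      Dx * Dy * ((x + 1#) * (f′ * (y + 1#) - g′ * (x + 1#)))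
        ≈⟨ solve 6 (λ a b x y f g → a :* b :* (x :* (f :* y :- g :* x))
            := x :* (f :* a :* b :* y :- g :* b :* a :* x)) refl Dx Dy (x + 1#) (y + 1#) f′ g′ ⟩
      (x + 1#) * (f′ * Dx * Dy * (y + 1#) - g′ * Dy * Dx * (x + 1#))
        ≈⟨ *-congˡ (+-cong (*-congʳ (*-congʳ (arm-suc 1≤x b))) (-‿cong (*-congʳ (*-congʳ (arm-suc 1≤y b))))) ⟩
      (x + 1#) * (x * Dy * (y + 1#) - y * Dx * (x + 1#))
        ≈⟨ solve 4 (λ x y f g → (x :+ con (+ 1)) :* (x :* (y :+ con (+ 1) :- g) :* (y :+ con (+ 1)) :- y :* (x :+ con (+ 1) :- f) :* (x :+ con (+ 1)))
             := (y :- x) :* (x :* y :- con (+ 1)) :* (x :+ con (+ 1) :- f) :+ x :* (y :+ con (+ 1)) :* (f :* (y :+ con (+ 1)) :- g :* (x :+ con (+ 1)))) refl x y f g ⟩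
      (y - x) * (x * y - 1#) * Dx + x * (y + 1#) * (f * (y + 1#) - g * (x + 1#)) ∎

  -- Connects the recursion with the quotient (xᵃ - x)/(xᵃ - 1). Multiplied out, the equation
  -- survives at x = 1, and the induction never divides by xᵃ - 1.
  arm-closed : ∀ {x} → 1# ≤ x → ∀ b → arm b x * (x ^ suc b - 1#) ≈ x ^ suc b - x
  arm-closed {x} 1≤x zero = solve 1 (λ x → con (+ 0) :* (x :* con (+ 1) :- con (+ 1))
      := x :* con (+ 1) :- x) refl x
  arm-closed {x} 1≤x (suc b) = begin
    f′ * (x * P - 1#)
      ≈⟨ solve 4 (λ x p f g → g :* (x :* p :- con (+ 1))
          := g :* (x :+ con (+ 1) :- f) :* (p :- con (+ 1)) :+ g :* (f :* (p :- con (+ 1)) :- (p :- x))) refl x P f f′ ⟩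
    f′ * (x + 1# - f) * (P - 1#) + f′ * (f * (P - 1#) - (P - x))
                                                 ≈⟨ +-cong (*-congʳ (arm-suc 1≤x b)) (*-congˡ (trans (+-congʳ (arm-closed 1≤x b)) (-‿inverseʳ _))) ⟩
    x * (P - 1#) + f′ * 0#
      ≈⟨ solve 3 (λ x p g → x :* (p :- con (+ 1)) :+ g :* con (+ 0) := x :* p :- x) refl x P f′ ⟩
    x * P - x                                    ∎
    where
    P = x ^ suc b
    f = arm b x
    f′ = arm (suc b) x

  sum-mono-≤ : ∀ {n} (f g : Vector Carrier n) → (∀ i → f i ≤ g i) → sum f ≤ sum g
  sum-mono-≤ {zero}  f g f≤g = inj₂ refl
  sum-mono-≤ {suc n} f g f≤g = 0≤-⇒≤ (0≤+≤ (≤⇒0≤- (f≤g zero)) (≤⇒0≤- (sum-mono-≤ (tail f) (tail g) (f≤g ∘ suc))))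
    (solve 4 (λ a b c d → b :+ d :- (a :+ c)
        := b :- a :+ (d :- c)) refl (f zero) (g zero) (sum (tail f)) (sum (tail g)))

  sum-mono-< : ∀ {n} (f g : Vector Carrier (suc n)) → (∀ i → f i < g i) → sum f < sum g
  sum-mono-< f g f<g = 0<-⇒< (0<+≤ (<⇒0<- (f<g zero)) (≤⇒0≤- (sum-mono-≤ (tail f) (tail g) (inj₁ ∘ f<g ∘ suc))))
    (solve 4 (λ a b c d → b :+ d :- (a :+ c)
        := b :- a :+ (d :- c)) refl (f zero) (g zero) (sum (tail f)) (sum (tail g)))

  -- The finite arms have aᵢ = 1 + b i, and m arms are infinite.
  star : ∀ {n} → ℕ → Vector ℕ n → Carrier → Carrier
  star m b x = x + 1# - (m · 1# + sum (λ i → arm (b i) x))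

  -- The arms increase and enter with a minus sign, so only the summand x can make `star` grow; this
  -- is the jump condition of `intermediate-value`.
  star-jump : ∀ {n} m (b : Vector ℕ n) {x y} → 1# ≤ x → x ≤ y → star m b y - star m b x ≤ y - x
  star-jump m b {x} {y} 1≤x x≤y = 0≤-⇒≤
    (≤⇒0≤- (sum-mono-≤ (λ i → arm (b i) x) (λ i → arm (b i) y) (λ i → arm-mono 1≤x x≤y (b i))))
    (solve 5 (λ x y m s t → y :- x :- (y :+ con (+ 1) :- (m :+ t) :- (x :+ con (+ 1) :- (m :+ s)))
        := t :- s) refl
      x y (m · 1#) (sum (λ i → arm (b i) x)) (sum (λ i → arm (b i) y)))

  -- `star` divided by x + 1 is 1 minus the decreasing terms m/(x + 1) and f/(x + 1), hence strictly
  -- increasing. The solver identity is this statement with both denominators cleared.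
  star-neg : ∀ {n} m (b : Vector ℕ (suc n)) → (∀ i → 1 ℕ.≤ b i) → ∀ {x y} → 1# ≤ x → x < y →
             star m b y ≤ 0# → star m b x < 0#
  star-neg m b 1≤b {x} {y} 1≤x x<y y-star≤0 =
    0<-⇒< (0<*⇒0< (0<+≤ (0<x 1≤y) (inj₁ 0<1)) (<.<-respʳ-≈
        (solve 5 (λ x y m s t →
              s :* (y :+ con (+ 1)) :- t :* (x :+ con (+ 1)) :+ (m :* (y :- x) :+ (x :+ con (+ 1)) :* (con (+ 0) :- (y :+ con (+ 1) :- (m :+ t))))
              := (y :+ con (+ 1)) :* (con (+ 0) :- (x :+ con (+ 1) :- (m :+ s)))) refl x y (m · 1#) S T)
        (0<+≤ (<⇒0<- T<S) (0≤+≤ (0≤*≤ (0≤· m) (inj₁ (<⇒0<- x<y)))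
          (0≤*≤ (0≤+≤ (inj₁ (0<x 1≤x)) (inj₁ 0<1)) (≤⇒0≤- y-star≤0)))))) refl
    where
    1≤y = ≤.trans 1≤x (inj₁ x<y)
    S = sum (λ i → arm (b i) x)
    T = sum (λ i → arm (b i) y)
    strict : ∀ i → arm (b i) y * (x + 1#) < arm (b i) x * (y + 1#)
    strict i with b i | 1≤b i
    ... | suc b′ | _ = arm/-anti-strict 1≤x x<y b′
    T<S : T * (x + 1#) < S * (y + 1#)
    T<S = <.<-respˡ-≈ (sym (*-distribʳ-sum (x + 1#) (λ i → arm (b i) y)))
         (<.<-respʳ-≈ (sym (*-distribʳ-sum (y + 1#) (λ i → arm (b i) x)))
           (sum-mono-< _ _ strict))

  star-root-unique : ∀ {n} m (b : Vector ℕ (suc n)) → (∀ i → 1 ℕ.≤ b i) → ∀ {x y} → 1# ≤ x → 1# ≤ y →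
                     star m b x ≈ 0# → star m b y ≈ 0# → x ≈ y
  star-root-unique m b 1≤b {x} {y} 1≤x 1≤y x-root y-root with <.compare x y
  ... | tri< x<y _ _ = contradiction (star-neg m b 1≤b 1≤x x<y (inj₂ y-root)) (<.irrefl x-root)
  ... | tri≈ _ x≈y _ = x≈y
  ... | tri> _ _ y<x = contradiction (star-neg m b 1≤b 1≤y y<x (inj₂ x-root)) (<.irrefl y-root)

  -- At 1 an infinite arm counts 1, and the first two finite arms count at least 1 - 1/2 and 1 -
  -- 1/3, so `star` is at most 2 - 1 - 1/2 - 2/3 = -1/6 there.
  star-root : ∀ {n} m (b : Vector ℕ (suc (suc n))) → 1 ℕ.≤ m → 1 ℕ.≤ b zero → 2 ℕ.≤ b (suc zero) →
              ∃[ θ ] 1# < θ × star m b θ ≈ 0#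
  star-root {n} m b 1≤m 1≤b₀ 2≤b₁ =
    let θ , 1<θ , _ , root = intermediate-value (star m b) 1<top star-1<0 0<star-top (star-jump m b)
    in θ , 1<θ , root
    where
    -- At this point `star` equals n + 2 minus the sum of the n + 2 finite arms, each of which is
    -- below 1.
    top = m · 1# + suc n · 1#
    0≤top-2 : 0# ≤ top - (1# + 1#)
    0≤top-2 = ≤.trans (0≤+≤ (≤⇒0≤- (·-mono 1≤m)) (0≤· n))
      (inj₂ (solve 2 (λ m n → m :- (con (+ 1) :+ con (+ 0)) :+ n
          := m :+ (con (+ 1) :+ n) :- con (+ 2)) refl (m · 1#) (n · 1#)))
    1<top : 1# < top
    1<top = 0<-⇒< (0≤+< 0≤top-2 0<1) (solve 1 (λ t → t :- con (+ 1) := t :- con (+ 2) :+ con (+ 1)) refl top)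
    1≤1 : 1# ≤ 1#
    1≤1 = inj₂ refl
    f₀ = arm (b zero) 1#
    f₁ = arm (b (suc zero)) 1#
    rest = sum (λ i → arm (b (suc (suc i))) 1#)
    6· : 0# < (1# + 1#) * (1# + 1# + 1#)
    6· = *-pos 0<2 (0<+≤ 0<2 (inj₁ 0<1))
    -- The factor 6 clears the denominators 2 and 3: six times `- star` is 1 plus nonnegative
    -- multiples of m - 1, of the remaining arms, of 1 - 2 (1 - f₀) and of 1 - 3 (1 - f₁).
    star-1<0 : star m b 1# < 0#
    star-1<0 = 0<-⇒< (0<*⇒0< 6· (<.<-respʳ-≈
      (solve 4 (λ m f g s →
         con (+ 1) :+ (con (+ 6) :* ((m :- (con (+ 1) :+ con (+ 0))) :+ s)
           :+ con (+ 3) :* (con (+ 1) :- (con (+ 1) :+ (con (+ 1) :+ con (+ 0))) :* (con (+ 1) :- f))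
           :+ con (+ 2) :* (con (+ 1) :- (con (+ 1) :+ (con (+ 1) :+ (con (+ 1) :+ con (+ 0)))) :* (con (+ 1) :- g)))
         := (con (+ 1) :+ con (+ 1)) :* (con (+ 1) :+ con (+ 1) :+ con (+ 1)) :* (con (+ 0) :- (con (+ 1) :+ con (+ 1) :- (m :+ (f :+ (g :+ s)))))) refl (m · 1#) f₀ f₁ rest)
      (0<+≤ 0<1 (0≤+≤ (0≤+≤
        (0≤*≤ (inj₁ (0<con 6)) (0≤+≤ (≤⇒0≤- (·-mono 1≤m)) 0≤rest))
        (0≤*≤ (inj₁ (0<con 3)) (≤⇒0≤- (n*gap≤1 {n = 2} 1≤1 (s≤s 1≤b₀)))))
        (0≤*≤ (inj₁ (0<con 2)) (≤⇒0≤- (n*gap≤1 {n = 3} 1≤1 (s≤s 2≤b₁)))))))) refl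
      where
      open import Algebra.Properties.Semiring.Mult.TCOptimised semiring using () renaming (_×_ to _·′_)
      0<con : ∀ n → .{{_ : ℕ.NonZero n}} → 0# < n ·′ 1#
      0<con (suc zero)          = 0<1
      0<con (suc n@(suc _)) = 0<+≤ (0<con n) (inj₁ 0<1)
      0≤rest : 0# ≤ rest
      0≤rest = ≤.trans (inj₂ (sym (sum-replicate-zero n))) (sum-mono-≤ {n} (λ _ → 0#) _ (λ i → 0≤arm 1≤1 (b (suc (suc i)))))
    0<star-top : 0# < star m b top
    0<star-top = <.<-respʳ-≈
      (trans (+-congʳ (sum-replicate (suc (suc n)))) (solve 3 (λ m n s → con (+ 1) :+ (con (+ 1) :+ n) :- s
          := m :+ (con (+ 1) :+ n) :+ con (+ 1) :- (m :+ s)) refl (m · 1#) (n · 1#) (sum (λ i → arm (b i) top))))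
      (<⇒0<- (sum-mono-< _ (λ _ → 1#) (λ i → arm<1 (inj₁ 1<top) (b i))))

  sum-gap : ∀ {n} (b : Vector ℕ n) x → sum (λ i → 1# - arm (b i) x) ≈ n · 1# - sum (λ i → arm (b i) x)
  sum-gap {zero}  b x = sym (-‿inverseʳ 0#)
  sum-gap {suc n} b x = trans (+-congˡ (sum-gap (tail b) x))
    (solve 3 (λ f n s → con (+ 1) :- f :+ (n :- s)
        := con (+ 1) :+ n :- (f :+ s)) refl (arm (b zero) x) (n · 1#) _)

  -- Shortening infinite arms adds their gaps 1 - arm (c i) x to star; these are
  -- positive, and small at a fixed x < θ when the c i are large.
  star-perturbed-root : ∀ {n m} (b : Vector ℕ (suc n)) → (∀ i → 1 ℕ.≤ b i) → ExcludedMiddle 0ℓ →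
    ∀ {θ} → 1# < θ → star (suc m) b θ ≈ 0# → ∀ {ε} → 0# < ε →
    ∃[ N ] ∀ {n′} (a : Vector ℕ n′) (c : Vector ℕ (suc m)) →
      (∀ x → sum (λ i → arm (a i) x) ≈ sum (λ i → arm (b i) x) + sum (λ i → arm (c i) x)) →
      (∀ i → N ℕ.≤ suc (c i)) →
      ∃[ τ ] 1# < τ × θ - ε < τ × τ < θ × star 0 a τ ≈ 0#
  star-perturbed-root {n} {m} b 1≤b em {θ} 1<θ root {ε} 0<ε with dense₂ (<⇒0<- 1<θ) 0<ε
  ... | d , 0<d , d<θ-1 , d<ε = N , λ a c split N≤c →
    let τ , x<τ , τ<θ , τ-root = intermediate-value (star 0 a) x<θ
          (neg a c split N≤c)
          (pos a c split)
          (λ x≤y → star-jump 0 a (≤.trans (inj₁ 1<x) x≤y))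
    in τ , <.trans 1<x x<τ , <.trans θ-ε<x x<τ , τ<θ , τ-root
    where
    x = θ - d
    x<θ : x < θ
    x<θ = 0<-⇒< 0<d (solve 2 (λ t d → t :- (t :- d) := d) refl θ d)
    1<x : 1# < x
    1<x = 0<-⇒< (<⇒0<- d<θ-1) (solve 2 (λ t d → t :- d :- con (+ 1) := t :- con (+ 1) :- d) refl θ d)
    θ-ε<x : θ - ε < x
    θ-ε<x = 0<-⇒< (<⇒0<- d<ε) (solve 3 (λ t d e → t :- d :- (t :- e) := e :- d) refl θ d ε)
    M = suc m · 1#
    q = - star (suc m) b x
    0<q : 0# < q
    0<q = <0⇒0<- (star-neg (suc m) b 1≤b (inj₁ 1<x) x<θ (inj₂ root))
    -- Each gap at `x` is at most 1/N, so `(N · 1#) * gaps x ≤ M`; with M < N q the gaps stay below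
    -- `q` and cannot lift `star` to zero at `x`. Since `x` and `q` do not depend on `c`, one `N`
    -- serves all long arms.
    arch = archimedean em (M * q ⁻¹)
    N = proj₁ arch
    M<Nq : M < (N · 1#) * q
    M<Nq = 0<-⇒< (*-pos 0<q (<⇒0<- (proj₂ arch))) (sym (begin
      q * (N · 1# - M * q ⁻¹)
        ≈⟨ solve 4 (λ q n m i → q :* (n :- m :* i) := n :* q :- m :* (q :* i)) refl q (N · 1#) M (q ⁻¹) ⟩
      (N · 1#) * q - M * (q * q ⁻¹)
        ≈⟨ +-congˡ (-‿cong (trans (*-congˡ (⁻¹-inverseʳ q (0<⇒≉0 0<q))) (*-identityʳ M))) ⟩
      (N · 1#) * q - M               ∎))
    module _ {n′} (a : Vector ℕ n′) (c : Vector ℕ (suc m))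
      (split : ∀ x → sum (λ i → arm (a i) x) ≈ sum (λ i → arm (b i) x) + sum (λ i → arm (c i) x)) where
      gaps : Carrier → Carrier
      gaps y = sum (λ i → 1# - arm (c i) y)
      star-split : ∀ y → star 0 a y ≈ star (suc m) b y + gaps y
      star-split y = begin
        y + 1# - (0# + sum (λ i → arm (a i) y))     ≈⟨ +-congˡ (-‿cong (+-congˡ (split y))) ⟩
        y + 1# - (0# + (B + C))
          ≈⟨ solve 4 (λ y b c m → y :+ con (+ 1) :- (con (+ 0) :+ (b :+ c))
              := y :+ con (+ 1) :- (m :+ b) :+ (m :- c)) refl y B C M ⟩
        y + 1# - (M + B) + (M - C)                  ≈⟨ +-congˡ (sum-gap c y) ⟨
        star (suc m) b y + gaps y                   ∎
        where
        B = sum (λ i → arm (b i) y)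
        C = sum (λ i → arm (c i) y)
      pos : 0# < star 0 a θ
      pos = <.<-respʳ-≈ (sym (trans (star-split θ) (trans (+-congʳ root) (+-identityˡ _))))
        (≤-<-trans (inj₂ (sym (sum-replicate-zero (suc m))))
          (sum-mono-< (λ _ → 0#) _ (λ i → <⇒0<- (arm<1 (inj₁ 1<θ) (c i)))))
      module _ (N≤c : ∀ i → N ℕ.≤ suc (c i)) where
        N*gaps≤M : (N · 1#) * gaps x ≤ M
        N*gaps≤M = ≤.trans (inj₂ (*-distribˡ-sum (N · 1#) (λ i → 1# - arm (c i) x)))
          (≤.trans (sum-mono-≤ _ (λ _ → 1#) (λ i → n*gap≤1 (inj₁ 1<x) (N≤c i))) (inj₂ (sum-replicate (suc m))))
        0<N : 0# < N · 1#
        0<N = ≤-<-trans (0≤*≤ (0≤· (suc m)) (inj₁ (0<⇒0<⁻¹ 0<q))) (proj₂ arch)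
        neg : star 0 a x < 0#
        neg = 0<-⇒< (0<*⇒0< 0<N (<.<-respʳ-≈ (begin
          (N · 1#) * q - (N · 1#) * gaps x
            ≈⟨ solve 3 (λ n s g → n :* (:- s) :- n :* g
                := n :* (con (+ 0) :- (s :+ g))) refl (N · 1#) (star (suc m) b x) (gaps x) ⟩
          (N · 1#) * (0# - (star (suc m) b x + gaps x))   ≈⟨ *-congˡ (+-congˡ (-‿cong (star-split x))) ⟨
          (N · 1#) * (0# - star 0 a x)            ∎) (<⇒0<- (≤-<-trans N*gaps≤M M<Nq)))) refl

-- Field algebra linking the arms with `Q` and with the Coxeter polynomial.

module StarAlgebra
  (F : CommutativeRing 0ℓ 0ℓ) (_⁻¹ : CommutativeRing.Carrier F → CommutativeRing.Carrier F)
  (⁻¹-inverseʳ : ∀ x → ¬ CommutativeRing._≈_ F x (CommutativeRing.0# F) →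
                 CommutativeRing._≈_ F (CommutativeRing._*_ F x (x ⁻¹)) (CommutativeRing.1# F))
  where
  open CommutativeRing F hiding (zero)
  open IntegerSolver F
  open RawSemiringDefinitions (Semiring.rawSemiring semiring)
    using (sum; product; _^_) renaming (_×_ to _·_)
  open import Algebra.Properties.Semiring.Mult semiring using (×-homo-+)
  open import Algebra.Properties.Semiring.Sum semiring using (sum-cong-≋; *-distribˡ-sum)
  open import Algebra.Properties.CommutativeMonoid.Sum *-commutativeMonoid using ()
    renaming (sum-remove to product-remove)
  open import Relation.Binary.Reasoning.Setoid setoid

  private variable
    a : ℕ
    x y c z f g : Carrier

  infixl 7 _/_
  _/_ : Carrier → Carrier → Carrier
  x / y = x * y ⁻¹

  /-* : ¬ y ≈ 0# → x / y * y ≈ x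
  /-* {y} {x} y≉0 = begin
    x * y ⁻¹ * y     ≈⟨ solve 3 (λ x i y → x :* i :* y := x :* (y :* i)) refl x (y ⁻¹) y ⟩
    x * (y * y ⁻¹)   ≈⟨ *-congˡ (⁻¹-inverseʳ y y≉0) ⟩
    x * 1#           ≈⟨ *-identityʳ x ⟩
    x                ∎

  *-cancelʳ : ¬ c ≈ 0# → x * c ≈ y * c → x ≈ y
  *-cancelʳ {c} {x} {y} c≉0 xc≈yc = begin
    x              ≈⟨ expand x ⟩
    x * c * c ⁻¹   ≈⟨ *-congʳ xc≈yc ⟩
    y * c * c ⁻¹   ≈⟨ expand y ⟨
    y              ∎
    where
    expand : ∀ x → x ≈ x * c * c ⁻¹
    expand x = sym (trans (*-assoc x c (c ⁻¹)) (trans (*-congˡ (⁻¹-inverseʳ c c≉0)) (*-identityʳ x)))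

  *-zeroʳ⇒ : ¬ x ≈ 0# → x * y ≈ 0# → y ≈ 0#
  *-zeroʳ⇒ {x} {y} x≉0 xy≈0 = *-cancelʳ x≉0 (trans (*-comm y x) (trans xy≈0 (sym (zeroˡ x))))

  *-nonzero : ¬ x ≈ 0# → ¬ y ≈ 0# → ¬ x * y ≈ 0#
  *-nonzero x≉0 y≉0 xy≈0 = y≉0 (*-zeroʳ⇒ x≉0 xy≈0)

  /-nonzero : ¬ x ≈ 0# → ¬ y ≈ 0# → ¬ x / y ≈ 0#
  /-nonzero {x} {y} x≉0 y≉0 x/y≈0 =
    x≉0 (trans (sym (/-* y≉0)) (trans (*-congʳ x/y≈0) (zeroˡ y)))

  product-nonzero : ¬ 1# ≈ 0# → ∀ {n} (f : Vector Carrier n) → (∀ i → ¬ f i ≈ 0#) → ¬ product f ≈ 0#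
  product-nonzero 1≉0 {zero}  f f≉0 = 1≉0
  product-nonzero 1≉0 {suc n} f f≉0 = *-nonzero (f≉0 zero) (product-nonzero 1≉0 (tail f) (f≉0 ∘ suc))

  -- An equation and not a quotient, so that it covers the complex quotient, the image of the
  -- recursive real `arm` and, on the unit circle, the number z f̄; where zᵃ differs from 1,
  -- `IsArm-unique` identifies any two of them.
  IsArm : ℕ → Carrier → Carrier → Set
  IsArm a z f = f * (z ^ a - 1#) ≈ z ^ a - z

  IsArm-/ : ¬ z ^ a - 1# ≈ 0# → IsArm a z ((z ^ a - z) / (z ^ a - 1#))
  IsArm-/ = /-*

  IsArm-unique : ¬ z ^ a - 1# ≈ 0# → IsArm a z f → IsArm a z g → f ≈ g
  IsArm-unique z^a≉1 f-arm g-arm = *-cancelʳ z^a≉1 (trans f-arm (sym g-arm))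

  IsArm-1 : ¬ z - 1# ≈ 0# → IsArm 1 z f → f ≈ 0#
  IsArm-1 {z} {f} z≉1 f-arm = *-cancelʳ z≉1 (begin
    f * (z - 1#)
      ≈⟨ solve 2 (λ z f → f :* (z :- con (+ 1)) := f :* (z :* con (+ 1) :- con (+ 1))) refl z f ⟩
    f * (z * 1# - 1#)    ≈⟨ f-arm ⟩
    z * 1# - z           ≈⟨ solve 1 (λ z → z :* con (+ 1) :- z := con (+ 0) :* (z :- con (+ 1))) refl z ⟩
    0# * (z - 1#)        ∎)

  IsArm-suc : ¬ z ^ a - 1# ≈ 0# → IsArm a z f → IsArm (suc a) z g → g * (z + 1# - f) ≈ z
  IsArm-suc {z} {a} {f} {g} z^a≉1 f-arm g-arm = *-cancelʳ z^a≉1 (begin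
    g * (z + 1# - f) * (P - 1#)
      ≈⟨ solve 4 (λ z p f g → g :* (z :+ con (+ 1) :- f) :* (p :- con (+ 1))
          := g :* (z :* p :- con (+ 1)) :- g :* (f :* (p :- con (+ 1)) :- (p :- z))) refl z P f g ⟩
    g * (z * P - 1#) - g * (f * (P - 1#) - (P - z))
      ≈⟨ +-cong g-arm (-‿cong (*-congˡ (trans (+-congʳ f-arm) (-‿inverseʳ _)))) ⟩
    z * P - z - g * 0#
      ≈⟨ solve 3 (λ z p g → z :* p :- z :- g :* con (+ 0) := z :* (p :- con (+ 1))) refl z P g ⟩
    z * (P - 1#)                                 ∎)
    where P = z ^ a

  star-value : ∀ {n} → ℕ → Vector Carrier n → Carrier → Carrier
  star-value m f z = z + 1# - (m · 1# + sum f)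

  z*z^[a-1]-1 : ∀ a → 1 ℕ.≤ a → ∀ z → z * (z ^ (a ℕ.∸ 1) - 1#) ≈ z ^ a - z
  z*z^[a-1]-1 (suc a) _ z = solve 2 (λ z w → z :* (w :- con (+ 1)) := z :* w :- z) refl z (z ^ a)

  module _ {n} (a : Vector ℕ (suc n)) (1≤a : ∀ i → 1 ℕ.≤ a i)
           (z : Carrier) (f : Vector Carrier (suc n)) (f-arm : ∀ i → IsArm (a i) z (f i)) where
    private
      D : Vector Carrier (suc n)
      D i = z ^ a i - 1#

    clear-denominators :
      z * sum (λ i → (z ^ (a i ℕ.∸ 1) - 1#) * product (removeAt D i)) ≈ product D * sum f
    clear-denominators = begin
      z * sum (λ i → (z ^ (a i ℕ.∸ 1) - 1#) * product (removeAt D i))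
        ≈⟨ *-distribˡ-sum z (λ i → (z ^ (a i ℕ.∸ 1) - 1#) * product (removeAt D i)) ⟩
      sum (λ i → z * ((z ^ (a i ℕ.∸ 1) - 1#) * product (removeAt D i)))  ≈⟨ sum-cong-≋ (λ i → termwise i) ⟩
      sum (λ i → product D * f i)                                       ≈⟨ *-distribˡ-sum (product D) f ⟨
      product D * sum f                                                ∎
      where
      termwise : ∀ i → z * ((z ^ (a i ℕ.∸ 1) - 1#) * product (removeAt D i)) ≈ product D * f i
      termwise i = begin
        z * ((z ^ (a i ℕ.∸ 1) - 1#) * product (removeAt D i))   ≈⟨ *-assoc z _ _ ⟨
        z * (z ^ (a i ℕ.∸ 1) - 1#) * product (removeAt D i)
          ≈⟨ *-congʳ (trans (z*z^[a-1]-1 (a i) (1≤a i) z) (sym (f-arm i))) ⟩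
        f i * D i * product (removeAt D i)
          ≈⟨ solve 3 (λ f d p → f :* d :* p := d :* p :* f) refl (f i) (D i) (product (removeAt D i)) ⟩
        D i * product (removeAt D i) * f i                      ≈⟨ *-congʳ (product-remove {n} {i} D) ⟨
        product D * f i                                         ∎

    Q-factor : ∀ r k m → r ≡ m ℕ.+ k →
      (z + 1# - r · 1# + k · 1#) * product D - z * sum (λ i → (z ^ (a i ℕ.∸ 1) - 1#) * product (removeAt D i))
      ≈ product D * star-value m f z
    Q-factor r k m r≡m+k = begin
      (z + 1# - r · 1# + k · 1#) * product D - z * sum (λ i → (z ^ (a i ℕ.∸ 1) - 1#) * product (removeAt D i))
        ≈⟨ +-cong (*-congʳ (+-congʳ (+-congˡ (-‿cong (trans (reflexive (≡.cong (_· 1#) r≡m+k)) (×-homo-+ 1# m k)))))) (-‿cong clear-denominators) ⟩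
      (z + 1# - (m · 1# + k · 1#) + k · 1#) * product D - product D * sum f
        ≈⟨ solve 5 (λ z m k d s → (z :+ con (+ 1) :- (m :+ k) :+ k) :* d :- d :* s
            := d :* (z :+ con (+ 1) :- (m :+ s))) refl z (m · 1#) (k · 1#) (product D) (sum f) ⟩
      product D * star-value m f z ∎

    -- Moved inside the sum, the factor z turns (z^{a-1} - 1)/(zᵃ - 1) into the arm value (zᵃ -
    -- z)/(zᵃ - 1).
    coxeter-factor : (∀ i → ¬ D i ≈ 0#) →
      product (λ i → (z ^ a i - 1#) / (z - 1#)) *
      (z + 1# - z * sum (λ i → (z ^ (a i ℕ.∸ 1) - 1#) / (z ^ a i - 1#)))
      ≈ product (λ i → (z ^ a i - 1#) / (z - 1#)) * star-value 0 f z
    coxeter-factor D≉0 = *-congˡ (begin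
      z + 1# - z * sum (λ i → (z ^ (a i ℕ.∸ 1) - 1#) / D i)
        ≈⟨ +-congˡ (-‿cong (trans (*-distribˡ-sum z (λ i → (z ^ (a i ℕ.∸ 1) - 1#) / D i)) (sum-cong-≋ termwise))) ⟩
      z + 1# - sum f                                           ≈⟨ +-congˡ (-‿cong (+-identityˡ (sum f))) ⟨
      z + 1# - (0# + sum f)                                    ∎)
      where
      termwise : ∀ i → z * ((z ^ (a i ℕ.∸ 1) - 1#) / D i) ≈ f i
      termwise i = *-cancelʳ (D≉0 i) (begin
        z * ((z ^ (a i ℕ.∸ 1) - 1#) / D i) * D i     ≈⟨ trans (*-congʳ (sym (*-assoc z _ _))) (/-* (D≉0 i)) ⟩
        z * (z ^ (a i ℕ.∸ 1) - 1#)                   ≈⟨ z*z^[a-1]-1 (a i) (1≤a i) z ⟩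
        z ^ a i - z                                  ≈⟨ f-arm i ⟨
        f i * D i                                    ∎)

-- The complex field and the half-plane argument.

module ComplexField (ℝ : CompleteOrderedField) where
  open CompleteOrderedField ℝ hiding (zero)
  open RealAndComplex ℝ using (≮⇒≥)
  module ℂ = RealAndComplex.ℂ ℝ
  open IntegerSolver commutativeRing
  open RealAnalysis ℝ

  ℂ-commutativeRing : CommutativeRing 0ℓ 0ℓ
  ℂ-commutativeRing = record
    { Carrier = ℂ.Carrier
    ; _≈_ = ℂ._≈_
    ; _+_ = ℂ._+_
    ; _*_ = ℂ._*_
    ; -_ = ℂ.-_
    ; 0# = ℂ.0#
    ; 1# = ℂ.1#
    ; isCommutativeRing = record
      { isRing = record
        { +-isAbelianGroup = record
          { isGroup = record
            { isMonoid = record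
              { isSemigroup = record
                { isMagma = record
                  { isEquivalence = record
                    { refl = refl , refl
                    ; sym = λ (p , q) → sym p , sym q
                    ; trans = λ (p , q) (r , s) → trans p r , trans q s
                    }
                  ; ∙-cong = λ (p , q) (r , s) → +-cong p r , +-cong q s
                  }
                ; assoc = λ _ _ _ → +-assoc _ _ _ , +-assoc _ _ _
                }
              ; identity = (λ _ → +-identityˡ _ , +-identityˡ _) , (λ _ → +-identityʳ _ , +-identityʳ _)
              }
            ; inverse = (λ _ → -‿inverseˡ _ , -‿inverseˡ _) , (λ _ → -‿inverseʳ _ , -‿inverseʳ _)
            ; ⁻¹-cong = λ (p , q) → -‿cong p , -‿cong q
            }
          ; comm = λ _ _ → +-comm _ _ , +-comm _ _
          }
        ; *-cong = λ (p , q) (r , s) →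
            +-cong (*-cong p r) (-‿cong (*-cong q s)) , +-cong (*-cong p s) (*-cong q r)
        ; *-assoc = λ (a , b) (c , d) (e , f) →
            solve 6 (λ a b c d e f → (a :* c :- b :* d) :* e :- (a :* d :+ b :* c) :* f
                                  := a :* (c :* e :- d :* f) :- b :* (c :* f :+ d :* e)) refl a b c d e f ,
            solve 6 (λ a b c d e f → (a :* c :- b :* d) :* f :+ (a :* d :+ b :* c) :* e
                                  := a :* (c :* f :+ d :* e) :+ b :* (c :* e :- d :* f)) refl a b c d e f
        ; *-identity = (λ z → 1*z z) , (λ z → trans₂ (z*w z ℂ.1#) (1*z z))
        ; distrib =
            (λ (a , b) (c , d) (e , f) →
              solve 6 (λ a b c d e f → a :* (c :+ e) :- b :* (d :+ f)
                  := a :* c :- b :* d :+ (a :* e :- b :* f)) refl a b c d e f ,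
              solve 6 (λ a b c d e f → a :* (d :+ f) :+ b :* (c :+ e)
                  := a :* d :+ b :* c :+ (a :* f :+ b :* e)) refl a b c d e f) ,
            (λ (a , b) (c , d) (e , f) →
              solve 6 (λ a b c d e f → (c :+ e) :* a :- (d :+ f) :* b
                  := c :* a :- d :* b :+ (e :* a :- f :* b)) refl a b c d e f ,
              solve 6 (λ a b c d e f → (c :+ e) :* b :+ (d :+ f) :* a
                  := c :* b :+ d :* a :+ (e :* b :+ f :* a)) refl a b c d e f)
        }
      ; *-comm = z*w
      }
    }
    where
    trans₂ : ∀ {z w u} → z ℂ.≈ w → w ℂ.≈ u → z ℂ.≈ u
    trans₂ (p , q) (r , s) = trans p r , trans q s
    1*z : ∀ z → ℂ.1# ℂ.* z ℂ.≈ z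
    1*z (x , y) = solve 2 (λ x y → con (+ 1) :* x :- con (+ 0) :* y := x) refl x y ,
                  solve 2 (λ x y → con (+ 1) :* y :+ con (+ 0) :* x := y) refl x y
    z*w : ∀ z w → z ℂ.* w ℂ.≈ w ℂ.* z
    z*w (a , b) (c , d) = solve 4 (λ a b c d → a :* c :- b :* d := c :* a :- d :* b) refl a b c d ,
                          solve 4 (λ a b c d → a :* d :+ b :* c := c :* b :+ d :* a) refl a b c d

  module ℂ× = CommutativeRing ℂ-commutativeRing

  normSq-pos : ∀ z → ¬ z ℂ.≈ ℂ.0# → 0# < ℂ.normSq z
  normSq-pos (x , y) z≉0 with x <.≟ 0#
  ... | no x≉0 = 0<+≤ (x≉0⇒0<x² x≉0) (0≤x² y)
  ... | yes x≈0 with y <.≟ 0#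
  ... | no y≉0  = 0≤+< (0≤x² x) (x≉0⇒0<x² y≉0)
  ... | yes y≈0 = contradiction (x≈0 , y≈0) z≉0

  ℂ-⁻¹-inverseʳ : ∀ z → ¬ z ℂ.≈ ℂ.0# → z ℂ.* z ℂ.⁻¹ ℂ.≈ ℂ.1#
  ℂ-⁻¹-inverseʳ z@(x , y) z≉0 =
    trans (solve 3 (λ x y n → x :* (x :* n) :- y :* (:- y :* n) := (x :* x :+ y :* y) :* n) refl x y _)
          (⁻¹-inverseʳ _ (0<⇒≉0 (normSq-pos z z≉0))) ,
    solve 3 (λ x y n → x :* (:- y :* n) :+ y :* (x :* n) := con (+ 0)) refl x y _

  open StarAlgebra ℂ-commutativeRing ℂ._⁻¹ ℂ-⁻¹-inverseʳ

  conj : ℂ.Carrier → ℂ.Carrier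
  conj (x , y) = x , - y

  conj-* : ∀ z w → conj (z ℂ.* w) ℂ.≈ conj z ℂ.* conj w
  conj-* (a , b) (c , d) = solve 4 (λ a b c d → a :* c :- b :* d := a :* c :- (:- b) :* (:- d)) refl a b c d ,
                           solve 4 (λ a b c d → :- (a :* d :+ b :* c)
                               := a :* (:- d) :+ (:- b) :* c) refl a b c d

  conj-cong : ∀ {z w} → z ℂ.≈ w → conj z ℂ.≈ conj w
  conj-cong (p , q) = p , -‿cong q

  conj-1 : conj ℂ.1# ℂ.≈ ℂ.1#
  conj-1 = refl , solve 0 (:- con (+ 0) := con (+ 0)) refl

  conj-- : ∀ z w → conj (z ℂ.- w) ℂ.≈ conj z ℂ.- conj w
  conj-- (a , b) (c , d) = refl , solve 2 (λ b d → :- (b :- d) := :- b :- (:- d)) refl b d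

  conj-^ : ∀ z n → conj (z ℂ.^ n) ℂ.≈ conj z ℂ.^ n
  conj-^ z zero    = conj-1
  conj-^ z (suc n) = ℂ×.trans (conj-* z (z ℂ.^ n)) (ℂ×.*-congˡ {conj z} {conj (z ℂ.^ n)} {conj z ℂ.^ n} (conj-^ z n))

  z*conj : ∀ z → z ℂ.* conj z ℂ.≈ ℂ.fromℝ (ℂ.normSq z)
  z*conj (x , y) = solve 2 (λ x y → x :* x :- y :* (:- y) := x :* x :+ y :* y) refl x y ,
                   solve 2 (λ x y → x :* (:- y) :+ y :* x := con (+ 0)) refl x y

  normSq-* : ∀ z w → ℂ.normSq (z ℂ.* w) ≈ ℂ.normSq z * ℂ.normSq w
  normSq-* (a , b) (c , d) = solve 4 (λ a b c d →
    (a :* c :- b :* d) :* (a :* c :- b :* d) :+ (a :* d :+ b :* c) :* (a :* d :+ b :* c)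
    := (a :* a :+ b :* b) :* (c :* c :+ d :* d)) refl a b c d

  normSq-cong : ∀ {z w} → z ℂ.≈ w → ℂ.normSq z ≈ ℂ.normSq w
  normSq-cong (p , q) = +-cong (*-cong p p) (*-cong q q)

  normSq-1 : ℂ.normSq ℂ.1# ≈ 1#
  normSq-1 = solve 0 (con (+ 1) :* con (+ 1) :+ con (+ 0) :* con (+ 0) := con (+ 1)) refl

  1≉0 : ¬ ℂ.1# ℂ.≈ ℂ.0#
  1≉0 (1≈0 , _) = 0<⇒≉0 0<1 1≈0

  1<normSq-^ : ∀ {z} → 1# < ℂ.normSq z → ∀ n → 1# < ℂ.normSq (z ℂ.^ suc n)
  1<normSq-^ {z} 1<z zero = <.<-respʳ-≈ (sym (normSq-cong {z ℂ.^ 1} {z} (ℂ×.*-identityʳ z))) 1<z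
  1<normSq-^ {z} 1<z (suc n) = <.<-respʳ-≈ (sym (normSq-* z (z ℂ.^ suc n)))
    (0<-⇒< (0<+≤ (*-pos (<⇒0<- 1<z) (<⇒0<- 1<w)) (0≤+≤ (≤⇒0≤- (inj₁ 1<z)) (≤⇒0≤- (inj₁ 1<w))))
      (solve 2 (λ z w → z :* w :- con (+ 1)
          := (z :- con (+ 1)) :* (w :- con (+ 1)) :+ (z :- con (+ 1) :+ (w :- con (+ 1)))) refl _ _))
    where 1<w = 1<normSq-^ {z} 1<z n

  z-w≈0⇒z≈w : ∀ z w → z ℂ.- w ℂ.≈ ℂ.0# → z ℂ.≈ w
  z-w≈0⇒z≈w (a , b) (c , d) (p , q) = cancel p , cancel q
    where
    cancel : ∀ {x y} → x - y ≈ 0# → x ≈ y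
    cancel {x} {y} x-y≈0 = trans (solve 2 (λ x y → x
        := x :- y :+ y) refl x y) (trans (+-congʳ x-y≈0) (+-identityˡ y))

  ^-1≉0 : ∀ {z} → 1# < ℂ.normSq z → ∀ n → ¬ z ℂ.^ suc n ℂ.- ℂ.1# ℂ.≈ ℂ.0#
  ^-1≉0 {z} 1<z n z^≈1 = <.irrefl
    (sym (trans (normSq-cong {z ℂ.^ suc n} {ℂ.1#} (z-w≈0⇒z≈w (z ℂ.^ suc n) ℂ.1# z^≈1)) normSq-1)) (1<normSq-^ {z} 1<z n)

  im : ℂ.Carrier → Carrier
  im = proj₂

  -- For ρ = ∣ z ∣, v is a positive multiple of the conjugate of a square root of z.
  record RootDirection (z : ℂ.Carrier) (ρ : Carrier) : Set where
    field
      v      : ℂ.Carrier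
      im-v<0 : im v < 0#
      zv≈ρv̄  : z ℂ.* v ℂ.≈ ℂ.fromℝ ρ ℂ.* conj v
      im-zv  : im ((z ℂ.+ ℂ.1#) ℂ.* v) ≈ (ρ - 1#) * - im v

  -- The number ρ + z̄ has the right direction up to sign, because z (ρ + z̄) = ρ (z + ρ). The
  -- factor `y` fixes the sign: the imaginary part becomes -y². On the real axis this degenerates,
  -- but there z is negative and -i serves.
  rootDirection : ∀ {x y ρ} → 0# ≤ ρ → ρ * ρ ≈ ℂ.normSq (x , y) → ¬ (0# < x × y ≈ 0#) →
                  ¬ (x , y) ℂ.≈ ℂ.0# → RootDirection (x , y) ρ
  rootDirection {x} {y} {ρ} 0≤ρ ρ² nonpos z≉0 with y <.≟ 0#
  ... | no y≉0 = record
    { v = y * (ρ + x) , - (y * y)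
    ; im-v<0 = 0<-⇒< (x≉0⇒0<x² y≉0) (solve 1 (λ y → con (+ 0) :- (:- (y :* y)) := y :* y) refl y)
    ; zv≈ρv̄ =
        trans (solve 3 (λ x y r → x :* (y :* (r :+ x)) :- y :* (:- (y :* y))
            := y :* (r :* x) :+ y :* (x :* x :+ y :* y)) refl x y ρ)
        (trans (+-congˡ (*-congˡ (sym ρ²)))
               (solve 3 (λ x y r → y :* (r :* x) :+ y :* (r :* r)
                   := r :* (y :* (r :+ x)) :- con (+ 0) :* (:- (:- (y :* y)))) refl x y ρ)) ,
        solve 3 (λ x y r → x :* (:- (y :* y)) :+ y :* (y :* (r :+ x))
            := r :* (:- (:- (y :* y))) :+ con (+ 0) :* (y :* (r :+ x))) refl x y ρ
    ; im-zv = solve 3 (λ x y r → (x :+ con (+ 1)) :* (:- (y :* y)) :+ (y :+ con (+ 0)) :* (y :* (r :+ x))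
        := (r :- con (+ 1)) :* (:- (:- (y :* y)))) refl x y ρ
    }
  ... | yes y≈0 = record
    { v = 0# , - 1#
    ; im-v<0 = 0<-⇒< 0<1 (solve 0 (con (+ 0) :- (:- con (+ 1)) := con (+ 1)) refl)
    ; zv≈ρv̄ =
        trans (solve 2 (λ x y → x :* con (+ 0) :- y :* (:- con (+ 1)) := y) refl x y)
        (trans y≈0 (solve 1 (λ r → con (+ 0) := r :* con (+ 0) :- con (+ 0) :* (:- (:- con (+ 1)))) refl ρ)) ,
        trans (solve 2 (λ x y → x :* (:- con (+ 1)) :+ y :* con (+ 0) := :- x) refl x y)
        (trans -x≈ρ (solve 1 (λ r → r := r :* (:- (:- con (+ 1))) :+ con (+ 0) :* con (+ 0)) refl ρ))
    ; im-zv = trans (solve 2 (λ x y → (x :+ con (+ 1)) :* (:- con (+ 1)) :+ (y :+ con (+ 0)) :* con (+ 0)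
        := :- x :- con (+ 1)) refl x y)
                (trans (+-congʳ -x≈ρ) (solve 1 (λ r → r :- con (+ 1)
                    := (r :- con (+ 1)) :* (:- (:- con (+ 1)))) refl ρ))
    }
    where
    x<0 : x < 0#
    x<0 with <.compare x 0#
    ... | tri< x<0 _ _ = x<0
    ... | tri≈ _ x≈0 _ = contradiction (x≈0 , y≈0) z≉0
    ... | tri> _ _ 0<x = contradiction (0<x , y≈0) nonpos
    sq : (- x) * (- x) ≈ ρ * ρ
    sq = trans (solve 1 (λ x → (:- x) :* (:- x) := x :* x :+ con (+ 0) :* con (+ 0)) refl x)
           (trans (+-congˡ (*-cong (sym y≈0) (sym y≈0))) (sym ρ²))
    -x≈ρ : - x ≈ ρ
    -x≈ρ = ≤.antisym (sq-cancel-≤ 0≤ρ (inj₂ sq)) (sq-cancel-≤ (inj₁ (<0⇒0<- x<0)) (inj₂ (sym sq)))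

  -- `p` is a positive multiple of the conjugate of `q`.
  im-neg : ∀ p q {c} → p ℂ.* q ℂ.≈ ℂ.fromℝ c → 0# < c → 0# < im q → im p < 0#
  im-neg (a , b) (c , d) {e} (re , imag) 0<e 0<d = 0<-⇒< (0<*⇒0< 0<n (<.<-respʳ-≈ (sym (begin
      (c * c + d * d) * (0# - b)
        ≈⟨ solve 4 (λ a b c d → (c :* c :+ d :* d) :* (con (+ 0) :- b)
            := d :* (a :* c :- b :* d) :- c :* (a :* d :+ b :* c)) refl a b c d ⟩
      d * (a * c - b * d) - c * (a * d + b * c)   ≈⟨ +-cong (*-congˡ re) (-‿cong (*-congˡ imag)) ⟩
      d * e - c * 0#                 ≈⟨ solve 3 (λ c d e → d :* e :- c :* con (+ 0) := d :* e) refl c d e ⟩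
      d * e                          ∎)) (*-pos 0<d 0<e))) refl
    where
    open import Relation.Binary.Reasoning.Setoid setoid
    0<n : 0# < c * c + d * d
    0<n = 0≤+< (0≤x² c) (*-pos 0<d 0<d)

  im-+1- : ∀ z g v → im ((z ℂ.+ ℂ.1# ℂ.- g) ℂ.* v) ≈ im ((z ℂ.+ ℂ.1#) ℂ.* v) - im (g ℂ.* v)
  im-+1- (x , y) (a , b) (c , d) =
    solve 6 (λ x y a b c d → (x :+ con (+ 1) :- a) :* d :+ (y :+ con (+ 0) :- b) :* c
      := (x :+ con (+ 1)) :* d :+ (y :+ con (+ 0)) :* c :- (a :* d :+ b :* c)) refl x y a b c d

  module _ {z ρ} (direction : RootDirection z ρ) where
    open RootDirection direction

    private
      0<-im-v : 0# < - im v
      0<-im-v = <0⇒0<- im-v<0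
      module ℂs = IntegerSolver ℂ-commutativeRing

    -- The recurrence of the arms preserves the half-plane im (f v) ≤ 0.
    im-arm≤0 : 1# < ρ → 1# < ℂ.normSq z → ∀ b {f} → IsArm (suc b) z f → im (f ℂ.* v) ≤ 0#
    im-arm≤0 1<ρ 1<z zero {f} f-arm = inj₂ (trans (+-cong (*-congʳ (proj₁ f≈0)) (*-congʳ (proj₂ f≈0)))
        (solve 2 (λ a b → con (+ 0) :* a :+ con (+ 0) :* b := con (+ 0)) refl _ _))
      where
      f≈0 : f ℂ.≈ ℂ.0#
      f≈0 = IsArm-1 (λ z-1≈0 → ^-1≉0 {z} 1<z 0 (ℂ×.trans (ℂ×.+-congʳ (ℂ×.*-identityʳ z)) z-1≈0)) f-arm
    im-arm≤0 1<ρ 1<z (suc b) {f′} f′-arm = inj₁ (im-neg (f′ ℂ.* v) (A ℂ.* v) product-eq 0<c 0<im-Av)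
      where
      f = (z ℂ.^ suc b ℂ.- z) / (z ℂ.^ suc b ℂ.- ℂ.1#)
      f-arm : IsArm (suc b) z f
      f-arm = IsArm-/ {z} {suc b} (^-1≉0 {z} 1<z b)
      A = z ℂ.+ ℂ.1# ℂ.- f
      c = ρ * ℂ.normSq v
      0<c : 0# < c
      0<c = *-pos (<.trans 0<1 1<ρ) (0≤+< (0≤x² _)
        (x≉0⇒0<x² λ im-v≈0 → <.irrefl im-v≈0 im-v<0))
      0<im-Av : 0# < im (A ℂ.* v)
      0<im-Av = <.<-respʳ-≈ (sym (trans (im-+1- z f v) (+-congʳ im-zv)))
        (0<+≤ (*-pos (<⇒0<- 1<ρ) 0<-im-v)
          (≤.trans (≤⇒0≤- (im-arm≤0 1<ρ 1<z b f-arm)) (inj₂ (+-identityˡ _))))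
      -- The recurrence f′ A = z turns the product into z v², and `zv≈ρv̄` turns this into ρ ∣v∣².
      -- Hence f′ v and A v lie on opposite sides of the real axis.
      product-eq : (f′ ℂ.* v) ℂ.* (A ℂ.* v) ℂ.≈ ℂ.fromℝ c
      product-eq = begin
        (f′ ℂ.* v) ℂ.* (A ℂ.* v)
          ≈⟨ ℂs.solve 3 (λ f v a → (f ℂs.:* v) ℂs.:* (a ℂs.:* v)
              ℂs.:= f ℂs.:* a ℂs.:* v ℂs.:* v) ℂ×.refl f′ v A ⟩
        f′ ℂ.* A ℂ.* v ℂ.* v
          ≈⟨ ℂ×.*-congʳ (ℂ×.*-congʳ (IsArm-suc {z} {suc b} {f} {f′} (^-1≉0 {z} 1<z b) f-arm f′-arm)) ⟩
        z ℂ.* v ℂ.* v                       ≈⟨ ℂ×.*-congʳ zv≈ρv̄ ⟩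
        ℂ.fromℝ ρ ℂ.* conj v ℂ.* v
          ≈⟨ ℂs.solve 3 (λ r w v → r ℂs.:* w ℂs.:* v
              ℂs.:= r ℂs.:* (v ℂs.:* w)) ℂ×.refl (ℂ.fromℝ ρ) (conj v) v ⟩
        ℂ.fromℝ ρ ℂ.* (v ℂ.* conj v)        ≈⟨ ℂ×.*-congˡ {ℂ.fromℝ ρ} (z*conj v) ⟩
        ℂ.fromℝ ρ ℂ.* ℂ.fromℝ (ℂ.normSq v)
          ≈⟨ solve 2 (λ a b → a :* b :- con (+ 0) :* con (+ 0) := a :* b) refl ρ (ℂ.normSq v) ,
                                               solve 2 (λ a b → a :* con (+ 0) :+ con (+ 0) :* b
                                                   := con (+ 0)) refl ρ (ℂ.normSq v) ⟩
        ℂ.fromℝ c                           ∎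
        where open import Relation.Binary.Reasoning.Setoid ℂ×.setoid

    -- On the unit circle z f̄ = f, so f v is real.
    im-unit-arm≤0 : ρ ≈ 1# → ℂ.normSq z ≈ 1# → ∀ a {f} → ¬ z ℂ.^ a ℂ.- ℂ.1# ℂ.≈ ℂ.0# → IsArm a z f → im (f ℂ.* v) ≤ 0#
    im-unit-arm≤0 ρ≈1 norm a {f} z^a≉1 f-arm = inj₂ (self-neg (proj₂ fv≈conj))
      where
      open import Relation.Binary.Reasoning.Setoid ℂ×.setoid
      self-neg : ∀ {t} → t ≈ - t → t ≈ 0#
      self-neg {t} t≈-t = ≤.antisym
        (≮⇒≥ λ 0<t → <-irrefl (<.trans 0<t (<.<-respˡ-≈ (sym t≈-t) (0<-⇒< 0<t (solve 1 (λ t → con (+ 0) :- (:- t)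
            := t) refl t)))))
        (≮⇒≥ λ t<0 → <-irrefl (<.trans t<0 (<.<-respʳ-≈ (sym t≈-t) (<0⇒0<- t<0))))
      P = z ℂ.^ a
      z̄ = conj z
      W = z̄ ℂ.^ a
      f̄ = conj f
      zz̄≈1 : z ℂ.* z̄ ℂ.≈ ℂ.1#
      zz̄≈1 = ℂ×.trans (z*conj z) (norm , refl)
      PW≈1 : P ℂ.* W ℂ.≈ ℂ.1#
      PW≈1 = begin
        P ℂ.* W                             ≈⟨ ℂ×.*-congˡ {P} (ℂ×.sym (conj-^ z a)) ⟩
        P ℂ.* conj P                        ≈⟨ z*conj P ⟩
        ℂ.fromℝ (ℂ.normSq P)                ≈⟨ norm^ a , refl ⟩
        ℂ.1#                                ∎
        where
        norm^ : ∀ a → ℂ.normSq (z ℂ.^ a) ≈ 1#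
        norm^ zero    = normSq-1
        norm^ (suc a) = trans (normSq-* z (z ℂ.^ a)) (trans (*-cong norm (norm^ a)) (*-identityʳ 1#))
      f̄-arm : f̄ ℂ.* (W ℂ.- ℂ.1#) ℂ.≈ W ℂ.- z̄
      f̄-arm = begin
        f̄ ℂ.* (W ℂ.- ℂ.1#)
          ≈⟨ ℂ×.*-congˡ {f̄} (ℂ×.+-cong (ℂ×.sym (conj-^ z a)) (ℂ×.-‿cong (ℂ×.sym conj-1))) ⟩
        f̄ ℂ.* (conj P ℂ.- conj ℂ.1#)        ≈⟨ ℂ×.*-congˡ {f̄} (ℂ×.sym (conj-- P ℂ.1#)) ⟩
        f̄ ℂ.* conj (P ℂ.- ℂ.1#)             ≈⟨ ℂ×.sym (conj-* f (P ℂ.- ℂ.1#)) ⟩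
        conj (f ℂ.* (P ℂ.- ℂ.1#))           ≈⟨ conj-cong f-arm ⟩
        conj (P ℂ.- z)                      ≈⟨ conj-- P z ⟩
        conj P ℂ.- z̄                        ≈⟨ ℂ×.+-congʳ {ℂ.- z̄} (conj-^ z a) ⟩
        W ℂ.- z̄                             ∎
      -- On the unit circle conjugation inverts z and P = zᵃ, so multiplying the conjugated equation
      -- `f̄-arm` by -z P gives an arm equation at z again.
      zf̄-arm : IsArm a z (f̄ ℂ.* z)
      zf̄-arm = begin
        f̄ ℂ.* z ℂ.* (P ℂ.- ℂ.1#)
          ≈⟨ ℂs.solve 4 (λ f z p w → f ℂs.:* z ℂs.:* (p ℂs.:- ℂs.con (+ 1))
              ℂs.:= f ℂs.:* z ℂs.:* (p ℂs.:* w ℂs.:- ℂs.con (+ 1)) ℂs.:- z ℂs.:* p ℂs.:* (f ℂs.:* (w ℂs.:- ℂs.con (+ 1)))) ℂ×.refl f̄ z P W ⟩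
        f̄ ℂ.* z ℂ.* (P ℂ.* W ℂ.- ℂ.1#) ℂ.- z ℂ.* P ℂ.* (f̄ ℂ.* (W ℂ.- ℂ.1#))
          ≈⟨ ℂ×.+-cong (ℂ×.*-congˡ {f̄ ℂ.* z} (ℂ×.+-congʳ {ℂ.- ℂ.1#} PW≈1)) (ℂ×.-‿cong (ℂ×.*-congˡ {z ℂ.* P} f̄-arm)) ⟩
        f̄ ℂ.* z ℂ.* (ℂ.1# ℂ.- ℂ.1#) ℂ.- z ℂ.* P ℂ.* (W ℂ.- z̄)
          ≈⟨ ℂs.solve 5 (λ f z p w y → f ℂs.:* z ℂs.:* (ℂs.con (+ 1) ℂs.:- ℂs.con (+ 1)) ℂs.:- z ℂs.:* p ℂs.:* (w ℂs.:- y)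
              ℂs.:= p ℂs.:* (z ℂs.:* y) ℂs.:- z ℂs.:* (p ℂs.:* w)) ℂ×.refl f̄ z P W z̄ ⟩
        P ℂ.* (z ℂ.* z̄) ℂ.- z ℂ.* (P ℂ.* W)
          ≈⟨ ℂ×.+-cong (ℂ×.*-congˡ {P} zz̄≈1) (ℂ×.-‿cong (ℂ×.*-congˡ {z} PW≈1)) ⟩
        P ℂ.* ℂ.1# ℂ.- z ℂ.* ℂ.1#
          ≈⟨ ℂ×.+-cong (ℂ×.*-identityʳ P) (ℂ×.-‿cong (ℂ×.*-identityʳ z)) ⟩
        P ℂ.- z ∎
      fv≈conj : f ℂ.* v ℂ.≈ conj (f ℂ.* v)
      fv≈conj = begin
        f ℂ.* v                             ≈⟨ ℂ×.*-congʳ {v} (IsArm-unique {z} {a} z^a≉1 f-arm zf̄-arm) ⟩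
        f̄ ℂ.* z ℂ.* v                       ≈⟨ ℂ×.*-assoc f̄ z v ⟩
        f̄ ℂ.* (z ℂ.* v)                     ≈⟨ ℂ×.*-congˡ {f̄} zv≈ρv̄ ⟩
        f̄ ℂ.* (ℂ.fromℝ ρ ℂ.* conj v)        ≈⟨ ℂ×.*-congˡ {f̄} (ℂ×.*-congʳ {conj v} (ρ≈1 , refl)) ⟩
        f̄ ℂ.* (ℂ.1# ℂ.* conj v)             ≈⟨ ℂ×.*-congˡ {f̄} (ℂ×.*-identityˡ (conj v)) ⟩
        f̄ ℂ.* conj v                        ≈⟨ ℂ×.sym (conj-* f v) ⟩
        conj (f ℂ.* v)                      ∎

    im-sum≤0 : ∀ {n} (f : Vector ℂ.Carrier n) → (∀ i → im (f i ℂ.* v) ≤ 0#) → im (ℂ.sum f ℂ.* v) ≤ 0#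
    im-sum≤0 {zero}  f f≤0 = inj₂ (proj₂ (ℂ×.zeroˡ v))
    im-sum≤0 {suc n} f f≤0 = 0≤-⇒≤ (0≤+≤ (≤⇒0≤- (f≤0 zero)) (≤⇒0≤- (im-sum≤0 (tail f) (f≤0 ∘ suc))))
      (trans (+-congˡ (-‿cong (proj₂ (ℂ×.distribʳ v (f zero) (ℂ.sum (tail f))))))
        (solve 2 (λ a b → con (+ 0) :- (a :+ b)
            := con (+ 0) :- a :+ (con (+ 0) :- b)) refl (im (f zero ℂ.* v)) (im (ℂ.sum (tail f) ℂ.* v))))

    im-·≤0 : ∀ m → im ((m ℂ.· ℂ.1#) ℂ.* v) ≤ 0#
    im-·≤0 zero    = inj₂ (proj₂ (ℂ×.zeroˡ v))
    im-·≤0 (suc m) = 0≤-⇒≤ (0≤+≤ (inj₁ 0<-im-v) (≤⇒0≤- (im-·≤0 m)))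
      (trans (+-congˡ (-‿cong (trans (proj₂ (ℂ×.distribʳ v ℂ.1# (m ℂ.· ℂ.1#))) (+-congʳ (proj₂ (ℂ×.*-identityˡ v))))))
        (solve 2 (λ a b → con (+ 0) :- (a :+ b)
            := :- a :+ (con (+ 0) :- b)) refl (im v) (im ((m ℂ.· ℂ.1#) ℂ.* v))))

    im-·<0 : ∀ m → 1 ℕ.≤ m → im ((m ℂ.· ℂ.1#) ℂ.* v) < 0#
    im-·<0 (suc m) _ = 0<-⇒< (0<+≤ 0<-im-v (≤⇒0≤- (im-·≤0 m)))
      (trans (+-congˡ (-‿cong (trans (proj₂ (ℂ×.distribʳ v ℂ.1# (m ℂ.· ℂ.1#))) (+-congʳ (proj₂ (ℂ×.*-identityˡ v))))))
        (solve 2 (λ a b → con (+ 0) :- (a :+ b)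
            := :- a :+ (con (+ 0) :- b)) refl (im v) (im ((m ℂ.· ℂ.1#) ℂ.* v))))

    -- After multiplication by `v`, the imaginary part is a sum of nonnegative contributions: (ρ -
    -- 1) (- im v) from z + 1, and those of the infinite and of the finite arms. The first is
    -- positive when ρ > 1; when ρ = 1 it vanishes and an infinite arm supplies the strictness.
    star-value-nonzero : ∀ {n} m (f : Vector ℂ.Carrier n) → (∀ i → im (f i ℂ.* v) ≤ 0#) →
                         1# < ρ ⊎ (ρ ≈ 1# × 1 ℕ.≤ m) → ¬ star-value m f z ℂ.≈ ℂ.0#
    star-value-nonzero m f f≤0 strict root = <.irrefl (sym (trans (sym total) im-root)) (0<total strict)
      where
      M = m ℂ.· ℂ.1#
      S = ℂ.sum f
      im-root : im ((z ℂ.+ ℂ.1# ℂ.- (M ℂ.+ S)) ℂ.* v) ≈ 0#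
      im-root = trans (proj₂ (ℂ×.*-congʳ {v} {star-value m f z} {ℂ.0#} root)) (proj₂ (ℂ×.zeroˡ v))
      T = (ρ - 1#) * - im v + ((0# - im (M ℂ.* v)) + (0# - im (S ℂ.* v)))
      total : im ((z ℂ.+ ℂ.1# ℂ.- (M ℂ.+ S)) ℂ.* v) ≈ T
      total = trans (im-+1- z (M ℂ.+ S) v) (trans (+-cong im-zv (-‿cong (proj₂ (ℂ×.distribʳ v M S))))
        (solve 3 (λ a b c → a :- (b :+ c)
            := a :+ ((con (+ 0) :- b) :+ (con (+ 0) :- c))) refl _ (im (M ℂ.* v)) (im (S ℂ.* v))))
      0<total : 1# < ρ ⊎ (ρ ≈ 1# × 1 ℕ.≤ m) → 0# < T
      0<total (inj₁ 1<ρ) = 0<+≤ (*-pos (<⇒0<- 1<ρ) 0<-im-v) (0≤+≤ (≤⇒0≤- (im-·≤0 m)) (≤⇒0≤- (im-sum≤0 f f≤0)))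
      0<total (inj₂ (ρ≈1 , 1≤m)) = 0≤+< (0≤*≤ (≤⇒0≤- (inj₂ (sym ρ≈1))) (inj₁ 0<-im-v))
                                        (0<+≤ (<⇒0<- (im-·<0 m 1≤m)) (≤⇒0≤- (im-sum≤0 f f≤0)))

-- Integer and rational coefficients inside ℂ.

module Embeddings (ℝ : CompleteOrderedField) where
  open CompleteOrderedField ℝ hiding (zero)
  open RealAndComplex ℝ using (fromℤ; fromℚ)
  open IntegerSolver commutativeRing
  open RealAnalysis ℝ
  open ComplexField ℝ
  open import Algebra.Properties.Semiring.Mult.TCOptimised semiring using (×ᵤ≈×)
  open StarAlgebra commutativeRing _⁻¹ ⁻¹-inverseʳ using (*-cancelʳ; /-*)
  open import Relation.Binary.Reasoning.Setoid setoid

  fromℤ≈⟦⟧ : ∀ i → fromℤ i ≈ ⟦ i ⟧ℤ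
  fromℤ≈⟦⟧ (+ n)    = ×ᵤ≈× n 1#
  fromℤ≈⟦⟧ -[1+ n ] = -‿cong (×ᵤ≈× (suc n) 1#)

  fromℤ-+ : ∀ i j → fromℤ (i ℤ.+ j) ≈ fromℤ i + fromℤ j
  fromℤ-+ i j = trans (fromℤ≈⟦⟧ (i ℤ.+ j)) (trans (⟦⟧-+-homo i j) (sym (+-cong (fromℤ≈⟦⟧ i) (fromℤ≈⟦⟧ j))))

  fromℤ-* : ∀ i j → fromℤ (i ℤ.* j) ≈ fromℤ i * fromℤ j
  fromℤ-* i j = trans (fromℤ≈⟦⟧ (i ℤ.* j)) (trans (⟦⟧-*-homo i j) (sym (*-cong (fromℤ≈⟦⟧ i) (fromℤ≈⟦⟧ j))))

  fromℤ-neg : ∀ i → fromℤ (ℤ.- i) ≈ - fromℤ i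
  fromℤ-neg i = trans (fromℤ≈⟦⟧ (ℤ.- i)) (trans (⟦⟧-‿homo i) (-‿cong (sym (fromℤ≈⟦⟧ i))))

  fromℤ-suc≉0 : ∀ n → ¬ fromℤ (+ suc n) ≈ 0#
  fromℤ-suc≉0 n = 0<⇒≉0 (0<+≤ 0<1 (0≤· n))
    where open RealArms ℝ using (0≤·)

  -- Arithmetic in ℚ reduces to lowest terms, which hides the numerators. Unnormalised fractions
  -- have explicit sums and products, and `fromℚᵘ-cong` absorbs the reduction.
  fromℚᵘ : ℚᵘ → Carrier
  fromℚᵘ p = fromℤ (ℚᵘ.↥ p) * fromℤ (ℚᵘ.↧ p) ⁻¹

  fromℚᵘ-unique : ∀ p {x} → x * fromℤ (ℚᵘ.↧ p) ≈ fromℤ (ℚᵘ.↥ p) → fromℚᵘ p ≈ x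
  fromℚᵘ-unique p@(mkℚᵘ n d) eq = *-cancelʳ (fromℤ-suc≉0 d) (trans (/-* (fromℤ-suc≉0 d)) (sym eq))

  fromℚᵘ-* : ∀ p → fromℚᵘ p * fromℤ (ℚᵘ.↧ p) ≈ fromℤ (ℚᵘ.↥ p)
  fromℚᵘ-* p@(mkℚᵘ n d) = /-* (fromℤ-suc≉0 d)

  fromℚᵘ-cong : ∀ {p q} → p ℚᵘ.≃ q → fromℚᵘ p ≈ fromℚᵘ q
  fromℚᵘ-cong {p@(mkℚᵘ _ d)} {q@(mkℚᵘ _ e)} (*≡* eq) = fromℚᵘ-unique p (*-cancelʳ (fromℤ-suc≉0 e) (begin
    fromℚᵘ q * fromℤ (ℚᵘ.↧ p) * fromℤ (ℚᵘ.↧ q)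
      ≈⟨ solve 3 (λ a b c → a :* b :* c := a :* c :* b) refl (fromℚᵘ q) (fromℤ (ℚᵘ.↧ p)) (fromℤ (ℚᵘ.↧ q)) ⟩
    fromℚᵘ q * fromℤ (ℚᵘ.↧ q) * fromℤ (ℚᵘ.↧ p)   ≈⟨ *-congʳ (fromℚᵘ-* q) ⟩
    fromℤ (ℚᵘ.↥ q) * fromℤ (ℚᵘ.↧ p)              ≈⟨ fromℤ-* (ℚᵘ.↥ q) (ℚᵘ.↧ p) ⟨
    fromℤ (ℚᵘ.↥ q ℤ.* ℚᵘ.↧ p)                    ≡⟨ ≡.cong fromℤ eq ⟨
    fromℤ (ℚᵘ.↥ p ℤ.* ℚᵘ.↧ q)                    ≈⟨ fromℤ-* (ℚᵘ.↥ p) (ℚᵘ.↧ q) ⟩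
    fromℤ (ℚᵘ.↥ p) * fromℤ (ℚᵘ.↧ q)              ∎))

  fromℚᵘ-+ : ∀ p q → fromℚᵘ (p ℚᵘ.+ q) ≈ fromℚᵘ p + fromℚᵘ q
  fromℚᵘ-+ p@(mkℚᵘ m d) q@(mkℚᵘ n e) = fromℚᵘ-unique (p ℚᵘ.+ q) (begin
    (fromℚᵘ p + fromℚᵘ q) * fromℤ (+ suc d ℤ.* + suc e)   ≈⟨ *-congˡ (fromℤ-* (+ suc d) (+ suc e)) ⟩
    (fromℚᵘ p + fromℚᵘ q) * (D * E)
      ≈⟨ solve 4 (λ p q d e → (p :+ q) :* (d :* e)
          := p :* d :* e :+ q :* e :* d) refl (fromℚᵘ p) (fromℚᵘ q) D E ⟩
    fromℚᵘ p * D * E + fromℚᵘ q * E * D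
      ≈⟨ +-cong (*-congʳ (fromℚᵘ-* p)) (*-congʳ (fromℚᵘ-* q)) ⟩
    fromℤ m * E + fromℤ n * D
      ≈⟨ +-cong (fromℤ-* m (+ suc e)) (fromℤ-* n (+ suc d)) ⟨
    fromℤ (m ℤ.* + suc e) + fromℤ (n ℤ.* + suc d)         ≈⟨ fromℤ-+ (m ℤ.* + suc e) (n ℤ.* + suc d) ⟨
    fromℤ (m ℤ.* + suc e ℤ.+ n ℤ.* + suc d)               ∎)
    where
    D = fromℤ (+ suc d)
    E = fromℤ (+ suc e)

  fromℚᵘ-*-homo : ∀ p q → fromℚᵘ (p ℚᵘ.* q) ≈ fromℚᵘ p * fromℚᵘ q
  fromℚᵘ-*-homo p@(mkℚᵘ m d) q@(mkℚᵘ n e) = fromℚᵘ-unique (p ℚᵘ.* q) (begin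
    fromℚᵘ p * fromℚᵘ q * fromℤ (+ suc d ℤ.* + suc e)     ≈⟨ *-congˡ (fromℤ-* (+ suc d) (+ suc e)) ⟩
    fromℚᵘ p * fromℚᵘ q * (D * E)
      ≈⟨ solve 4 (λ p q d e → p :* q :* (d :* e) := p :* d :* (q :* e)) refl (fromℚᵘ p) (fromℚᵘ q) D E ⟩
    fromℚᵘ p * D * (fromℚᵘ q * E)                         ≈⟨ *-cong (fromℚᵘ-* p) (fromℚᵘ-* q) ⟩
    fromℤ m * fromℤ n                                     ≈⟨ fromℤ-* m n ⟨
    fromℤ (m ℤ.* n)                                       ∎)
    where
    D = fromℤ (+ suc d)
    E = fromℤ (+ suc e)

  fromℚᵘ-neg : ∀ p → fromℚᵘ (ℚᵘ.- p) ≈ - fromℚᵘ p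
  fromℚᵘ-neg p@(mkℚᵘ m d) = fromℚᵘ-unique (ℚᵘ.- p) (begin
    - fromℚᵘ p * fromℤ (+ suc d)
      ≈⟨ solve 2 (λ p d → :- p :* d := :- (p :* d)) refl (fromℚᵘ p) (fromℤ (+ suc d)) ⟩
    - (fromℚᵘ p * fromℤ (+ suc d))     ≈⟨ -‿cong (fromℚᵘ-* p) ⟩
    - fromℤ m                          ≈⟨ fromℤ-neg m ⟨
    fromℤ (ℤ.- m)                      ∎)

  fromℚ≈ : ∀ p → fromℚ p ≈ fromℚᵘ (toℚᵘ p)
  fromℚ≈ (mkℚ _ _ _) = refl

  fromℚ-+ : ∀ p q → fromℚ (p ℚ.+ q) ≈ fromℚ p + fromℚ q
  fromℚ-+ p q = begin
    fromℚ (p ℚ.+ q)                      ≈⟨ fromℚ≈ (p ℚ.+ q) ⟩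
    fromℚᵘ (toℚᵘ (p ℚ.+ q))              ≈⟨ fromℚᵘ-cong (ℚ.toℚᵘ-homo-+ p q) ⟩
    fromℚᵘ (toℚᵘ p ℚᵘ.+ toℚᵘ q)          ≈⟨ fromℚᵘ-+ (toℚᵘ p) (toℚᵘ q) ⟩
    fromℚᵘ (toℚᵘ p) + fromℚᵘ (toℚᵘ q)    ≈⟨ +-cong (fromℚ≈ p) (fromℚ≈ q) ⟨
    fromℚ p + fromℚ q                    ∎

  fromℚ-* : ∀ p q → fromℚ (p ℚ.* q) ≈ fromℚ p * fromℚ q
  fromℚ-* p q = begin
    fromℚ (p ℚ.* q)                      ≈⟨ fromℚ≈ (p ℚ.* q) ⟩
    fromℚᵘ (toℚᵘ (p ℚ.* q))              ≈⟨ fromℚᵘ-cong (ℚ.toℚᵘ-homo-* p q) ⟩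
    fromℚᵘ (toℚᵘ p ℚᵘ.* toℚᵘ q)          ≈⟨ fromℚᵘ-*-homo (toℚᵘ p) (toℚᵘ q) ⟩
    fromℚᵘ (toℚᵘ p) * fromℚᵘ (toℚᵘ q)    ≈⟨ *-cong (fromℚ≈ p) (fromℚ≈ q) ⟨
    fromℚ p * fromℚ q                    ∎

  fromℚ-neg : ∀ p → fromℚ (ℚ.- p) ≈ - fromℚ p
  fromℚ-neg p = begin
    fromℚ (ℚ.- p)               ≈⟨ fromℚ≈ (ℚ.- p) ⟩
    fromℚᵘ (toℚᵘ (ℚ.- p))       ≈⟨ fromℚᵘ-cong (ℚ.toℚᵘ-homo‿- p) ⟩
    fromℚᵘ (ℚᵘ.- toℚᵘ p)        ≈⟨ fromℚᵘ-neg (toℚᵘ p) ⟩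
    - fromℚᵘ (toℚᵘ p)           ≈⟨ -‿cong (fromℚ≈ p) ⟨
    - fromℚ p                   ∎

  fromℚ-0 : fromℚ ℚ.0ℚ ≈ 0#
  fromℚ-0 = zeroˡ _

  fromℚ-1 : fromℚ ℚ.1ℚ ≈ 1#
  fromℚ-1 = ⁻¹-inverseʳ _ (fromℤ-suc≉0 0)

  fromℝ-* : ∀ x y → ℂ.fromℝ (x * y) ℂ.≈ ℂ.fromℝ x ℂ.* ℂ.fromℝ y
  fromℝ-* x y = solve 2 (λ x y → x :* y := x :* y :- con (+ 0) :* con (+ 0)) refl x y ,
                solve 2 (λ x y → con (+ 0) := x :* con (+ 0) :+ con (+ 0) :* y) refl x y

  fromℝ-neg : ∀ x → ℂ.fromℝ (- x) ℂ.≈ ℂ.- ℂ.fromℝ x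
  fromℝ-neg x = refl , solve 0 (con (+ 0) := :- con (+ 0)) refl

  fromℝ-+ : ∀ x y → ℂ.fromℝ (x + y) ℂ.≈ ℂ.fromℝ x ℂ.+ ℂ.fromℝ y
  fromℝ-+ x y = refl , sym (+-identityʳ 0#)

  module _ (A : RawRing 0ℓ 0ℓ) (ι : RawRing.Carrier A → Carrier) where
    private module A = RawRing A
    fromℝ∘-isRingHomomorphism :
      (∀ {a b} → a A.≈ b → ι a ≈ ι b) →
      (∀ a b → ι (a A.+ b) ≈ ι a + ι b) → (∀ a b → ι (a A.* b) ≈ ι a * ι b) →
      (∀ a → ι (A.- a) ≈ - ι a) → ι A.0# ≈ 0# → ι A.1# ≈ 1# →
      IsRingHomomorphism A ℂ×.rawRing (ℂ.fromℝ ∘ ι)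
    fromℝ∘-isRingHomomorphism cong +-homo *-homo -‿homo 0-homo 1-homo = record
      { isSemiringHomomorphism = record
        { isNearSemiringHomomorphism = record
          { +-isMonoidHomomorphism = record
            { isMagmaHomomorphism = record
              { isRelHomomorphism = record { cong = λ a≈b → cong a≈b , refl }
              ; homo = λ a b → trans (+-homo a b) (proj₁ (fromℝ-+ (ι a) (ι b))) , proj₂ (fromℝ-+ (ι a) (ι b))
              }
            ; ε-homo = 0-homo , refl
            }
          ; *-homo = λ a b → trans (*-homo a b) (proj₁ (fromℝ-* (ι a) (ι b))) , proj₂ (fromℝ-* (ι a) (ι b))
          }
        ; 1#-homo = 1-homo , refl
        }
      ; -‿homo = λ a → trans (-‿homo a) (proj₁ (fromℝ-neg (ι a))) , proj₂ (fromℝ-neg (ι a))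
      }

  fromℤ-isRingHomomorphism : IsRingHomomorphism ℤ.+-*-rawRing ℂ×.rawRing (ℂ.fromℝ ∘ fromℤ)
  fromℤ-isRingHomomorphism = fromℝ∘-isRingHomomorphism ℤ.+-*-rawRing fromℤ
    (λ i≡j → reflexive (≡.cong fromℤ i≡j)) fromℤ-+ fromℤ-* fromℤ-neg refl (+-identityʳ 1#)

  fromℚ-isRingHomomorphism : IsRingHomomorphism ℚ.+-*-rawRing ℂ×.rawRing (ℂ.fromℝ ∘ fromℚ)
  fromℚ-isRingHomomorphism = fromℝ∘-isRingHomomorphism ℚ.+-*-rawRing fromℚ
    (λ p≡q → reflexive (≡.cong fromℚ p≡q)) fromℚ-+ fromℚ-* fromℚ-neg fromℚ-0 fromℚ-1

  module ℤ[z] = PolynomialFunctions ℂ-commutativeRing ℤ.+-*-rawRing (ℂ.fromℝ ∘ fromℤ) fromℤ-isRingHomomorphism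
  module ℚ[z] = PolynomialFunctions ℂ-commutativeRing ℚ.+-*-rawRing (ℂ.fromℝ ∘ fromℚ) fromℚ-isRingHomomorphism

  fromℚ-inverse : ∀ p → ℂ.fromℝ (fromℚ p) ℂ.≈ ℂ.0# ⊎ ∃[ q ] ℂ.fromℝ (fromℚ q) ℂ.* ℂ.fromℝ (fromℚ p) ℂ.≈ ℂ.1#
  fromℚ-inverse p with p ℚ.≟ ℚ.0ℚ
  ... | yes p≡0 = inj₁ (trans (reflexive (≡.cong fromℚ p≡0)) fromℚ-0 , refl)
  ... | no p≢0  = inj₂ (ℚ.1/ p , ℂ×.trans (ℂ×.sym (fromℝ-* (fromℚ (ℚ.1/ p)) (fromℚ p)))
      (trans (sym (fromℚ-* (ℚ.1/ p) p)) (trans (reflexive (≡.cong fromℚ (ℚ.*-inverseˡ p))) fromℚ-1) , refl))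
    where instance _ = ℚ.≢-nonZero p≢0

-- Roots of the complex star function outside and on the unit circle.

module StarRoots (ℝ : CompleteOrderedField) where
  open CompleteOrderedField ℝ hiding (zero)
  open IntegerSolver commutativeRing
  open RealAnalysis ℝ
  open RealArms ℝ
  open ComplexField ℝ
  open Embeddings ℝ using (fromℝ-*; fromℝ-+; fromℝ-neg)
  open StarAlgebra ℂ-commutativeRing ℂ._⁻¹ ℂ-⁻¹-inverseʳ
  open RawSemiringDefinitions (Semiring.rawSemiring semiring) using (sum; _^_) renaming (_×_ to _·_)

  0≤∣_∣ : ∀ z → 0# ≤ ℂ.∣ z ∣
  0≤∣ z ∣ = √-nonneg (0≤+≤ (0≤x² _) (0≤x² _))

  ∣_∣-square : ∀ z → ℂ.∣ z ∣ * ℂ.∣ z ∣ ≈ ℂ.normSq z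
  ∣ z ∣-square = √-square (0≤+≤ (0≤x² _) (0≤x² _))

  normSq<⇒∣∣< : ∀ z {y} → 0# ≤ y → ℂ.normSq z < y * y → ℂ.∣ z ∣ < y
  normSq<⇒∣∣< z 0≤y n<y² = sq-cancel-< 0≤y (<.<-respˡ-≈ (sym ∣ z ∣-square) n<y²)

  normSq≤⇒∣∣≤ : ∀ z {y} → 0# ≤ y → ℂ.normSq z ≤ y * y → ℂ.∣ z ∣ ≤ y
  normSq≤⇒∣∣≤ z 0≤y n≤y² = sq-cancel-≤ 0≤y (≤.trans (inj₂ ∣ z ∣-square) n≤y²)

  1<normSq⇒1<∣∣ : ∀ z → 1# < ℂ.normSq z → 1# < ℂ.∣ z ∣
  1<normSq⇒1<∣∣ z 1<n = sq-cancel-< 0≤∣ z ∣ (<.<-respˡ-≈ (sym (*-identityʳ 1#)) (<.<-respʳ-≈ (sym ∣ z ∣-square) 1<n))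

  1<∣∣⇒1<normSq : ∀ z → 1# < ℂ.∣ z ∣ → 1# < ℂ.normSq z
  1<∣∣⇒1<normSq z 1<∣z∣ = <.<-respˡ-≈ (*-identityʳ 1#) (<.<-respʳ-≈ ∣ z ∣-square (*-mono-<-sq (inj₁ 0<1) 1<∣z∣))

  normSq-fromℝ : ∀ x → ℂ.normSq (ℂ.fromℝ x) ≈ x * x
  normSq-fromℝ x = solve 1 (λ x → x :* x :+ con (+ 0) :* con (+ 0) := x :* x) refl x

  1<normSq-fromℝ : ∀ {x} → 1# < x → 1# < ℂ.normSq (ℂ.fromℝ x)
  1<normSq-fromℝ {x} 1<x = <.<-respʳ-≈ (sym (normSq-fromℝ x))
    (<.<-respˡ-≈ (*-identityʳ 1#) (*-mono-<-sq (inj₁ 0<1) 1<x))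

  fromℝ-^ : ∀ x n → ℂ.fromℝ x ℂ.^ n ℂ.≈ ℂ.fromℝ (x ^ n)
  fromℝ-^ x zero    = ℂ×.refl
  fromℝ-^ x (suc n) = ℂ×.trans (ℂ×.*-congˡ {ℂ.fromℝ x} (fromℝ-^ x n)) (ℂ×.sym (fromℝ-* x (x ^ n)))

  fromℝ-- : ∀ x y → ℂ.fromℝ (x - y) ℂ.≈ ℂ.fromℝ x ℂ.- ℂ.fromℝ y
  fromℝ-- x y = ℂ×.trans (fromℝ-+ x (- y)) (ℂ×.+-congˡ {ℂ.fromℝ x} (fromℝ-neg y))

  fromℝ-· : ∀ n → n ℂ.· ℂ.1# ℂ.≈ ℂ.fromℝ (n · 1#)
  fromℝ-· zero    = ℂ×.refl
  fromℝ-· (suc n) = ℂ×.trans (ℂ×.+-congˡ {ℂ.1#} (fromℝ-· n)) (ℂ×.sym (fromℝ-+ 1# (n · 1#)))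

  fromℝ-sum : ∀ {n} (f : Vector Carrier n) → ℂ.sum (ℂ.fromℝ ∘ f) ℂ.≈ ℂ.fromℝ (sum f)
  fromℝ-sum {zero}  f = ℂ×.refl
  fromℝ-sum {suc n} f = ℂ×.trans (ℂ×.+-congˡ {ℂ.fromℝ (f zero)} (fromℝ-sum (tail f))) (ℂ×.sym (fromℝ-+ (f zero) (sum (tail f))))

  fromℝ-arm : ∀ {x} → 1# ≤ x → ∀ b → IsArm (suc b) (ℂ.fromℝ x) (ℂ.fromℝ (arm b x))
  fromℝ-arm {x} 1≤x b = begin
    ℂ.fromℝ f ℂ.* (ℂ.fromℝ x ℂ.^ suc b ℂ.- ℂ.1#)
      ≈⟨ ℂ×.*-congˡ {ℂ.fromℝ f} (ℂ×.+-congʳ {ℂ.- ℂ.1#} (fromℝ-^ x (suc b))) ⟩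
    ℂ.fromℝ f ℂ.* (ℂ.fromℝ P ℂ.- ℂ.1#)             ≈⟨ ℂ×.*-congˡ {ℂ.fromℝ f} (fromℝ-- P 1#) ⟨
    ℂ.fromℝ f ℂ.* ℂ.fromℝ (P - 1#)                 ≈⟨ fromℝ-* f (P - 1#) ⟨
    ℂ.fromℝ (f * (P - 1#))                         ≈⟨ arm-closed 1≤x b , refl ⟩
    ℂ.fromℝ (P - x)                                ≈⟨ fromℝ-- P x ⟩
    ℂ.fromℝ P ℂ.- ℂ.fromℝ x                        ≈⟨ ℂ×.+-congʳ {ℂ.- ℂ.fromℝ x} (fromℝ-^ x (suc b)) ⟨
    ℂ.fromℝ x ℂ.^ suc b ℂ.- ℂ.fromℝ x              ∎
    where
    open import Relation.Binary.Reasoning.Setoid ℂ×.setoid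
    f = arm b x
    P = x ^ suc b

  fromℝ-star : ∀ {n} m (b : Vector ℕ n) x →
               star-value m (λ i → ℂ.fromℝ (arm (b i) x)) (ℂ.fromℝ x) ℂ.≈ ℂ.fromℝ (star m b x)
  fromℝ-star m b x = begin
    ℂ.fromℝ x ℂ.+ ℂ.1# ℂ.- (m ℂ.· ℂ.1# ℂ.+ ℂ.sum (ℂ.fromℝ ∘ f))
      ≈⟨ ℂ×.+-cong (ℂ×.sym (fromℝ-+ x 1#)) (ℂ×.-‿cong (ℂ×.+-cong (fromℝ-· m) (fromℝ-sum f))) ⟩
    ℂ.fromℝ (x + 1#) ℂ.- (ℂ.fromℝ (m · 1#) ℂ.+ ℂ.fromℝ (sum f))
      ≈⟨ ℂ×.+-congˡ {ℂ.fromℝ (x + 1#)} (ℂ×.-‿cong (fromℝ-+ (m · 1#) (sum f))) ⟨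
    ℂ.fromℝ (x + 1#) ℂ.- ℂ.fromℝ (m · 1# + sum f)
      ≈⟨ fromℝ-- (x + 1#) (m · 1# + sum f) ⟨
    ℂ.fromℝ (star m b x) ∎
    where
    open import Relation.Binary.Reasoning.Setoid ℂ×.setoid
    f : Vector Carrier _
    f i = arm (b i) x

  ^-congˡ : ∀ {z w} n → z ℂ.≈ w → z ℂ.^ n ℂ.≈ w ℂ.^ n
  ^-congˡ zero    z≈w = ℂ×.refl
  ^-congˡ {z} {w} (suc n) z≈w = ℂ×.*-cong {z} {w} {z ℂ.^ n} {w ℂ.^ n} z≈w (^-congˡ n z≈w)

  IsArm-resp : ∀ {a z w f} → z ℂ.≈ w → IsArm a z f → IsArm a w f
  IsArm-resp {a} {z} {w} {f} z≈w f-arm = begin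
    f ℂ.* (w ℂ.^ a ℂ.- ℂ.1#)   ≈⟨ ℂ×.*-congˡ {f} (ℂ×.+-congʳ {ℂ.- ℂ.1#} (^-congˡ a z≈w)) ⟨
    f ℂ.* (z ℂ.^ a ℂ.- ℂ.1#)   ≈⟨ f-arm ⟩
    z ℂ.^ a ℂ.- z              ≈⟨ ℂ×.+-cong (^-congˡ a z≈w) (ℂ×.-‿cong z≈w) ⟩
    w ℂ.^ a ℂ.- w              ∎
    where open import Relation.Binary.Reasoning.Setoid ℂ×.setoid

  star-value-not-positive : ∀ {n} m (b : Vector ℕ n) z (f : Vector ℂ.Carrier n) → 1# < ℂ.normSq z →
    (∀ i → IsArm (suc (b i)) z (f i)) → ¬ (0# < proj₁ z × proj₂ z ≈ 0#) → ¬ star-value m f z ℂ.≈ ℂ.0#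
  star-value-not-positive m b z f 1<z f-arm z≯0 = star-value-nonzero direction m f
    (λ i → im-arm≤0 direction 1<ρ 1<z (b i) (f-arm i)) (inj₁ 1<ρ)
    where
    1<ρ = 1<normSq⇒1<∣∣ z 1<z
    direction = rootDirection 0≤∣ z ∣ ∣ z ∣-square z≯0 λ z≈0 →
      0<⇒≉0 (<.trans 0<1 1<z) (trans (normSq-cong {z} {ℂ.0#} z≈0) (trans (normSq-fromℝ 0#) (zeroˡ 0#)))

  star-value-unit-circle : ∀ {n} m (a : Vector ℕ (suc n)) z (f : Vector ℂ.Carrier (suc n)) →
    1 ℕ.≤ m → ℂ.normSq z ≈ 1# → (∀ i → ¬ z ℂ.^ a i ℂ.- ℂ.1# ℂ.≈ ℂ.0#) →
    (∀ i → IsArm (a i) z (f i)) → ¬ star-value m f z ℂ.≈ ℂ.0#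
  star-value-unit-circle m a z@(x , y) f 1≤m z≈1 z^≉1 f-arm = star-value-nonzero direction m f
    (λ i → im-unit-arm≤0 direction ρ≈1 z≈1 (a i) (z^≉1 i) (f-arm i)) (inj₂ (ρ≈1 , 1≤m))
    where
    ρ≈1 : ℂ.∣ z ∣ ≈ 1#
    ρ≈1 = ≤.antisym
      (sq-cancel-≤ (inj₁ 0<1) (inj₂ (trans ∣ z ∣-square (trans z≈1 (sym (*-identityʳ 1#))))))
      (sq-cancel-≤ 0≤∣ z ∣ (inj₂ (sym (trans ∣ z ∣-square (trans z≈1 (sym (*-identityʳ 1#)))))))
    1^ : ∀ n → ℂ.1# ℂ.^ n ℂ.≈ ℂ.1#
    1^ zero    = ℂ×.refl
    1^ (suc n) = ℂ×.trans (ℂ×.*-identityˡ (ℂ.1# ℂ.^ n)) (1^ n)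
    -- A positive real on the unit circle is 1, where every zᵃ - 1 vanishes, contrary to `z^≉1`.
    z≯0 : ¬ (0# < x × y ≈ 0#)
    z≯0 (0<x , y≈0) = z^≉1 zero (ℂ×.trans
      (ℂ×.+-congʳ {ℂ.- ℂ.1#} (ℂ×.trans (^-congˡ {z} {ℂ.1#} (a zero) (x≈1 , y≈0)) (1^ (a zero)))) (ℂ×.-‿inverseʳ ℂ.1#))
      where
      x²≈1 : x * x ≈ 1# * 1#
      x²≈1 = trans (sym (normSq-fromℝ x)) (trans (normSq-cong {ℂ.fromℝ x} {z} (refl , sym y≈0)) (trans z≈1 (sym (*-identityʳ 1#))))
      x≈1 : x ≈ 1#
      x≈1 = ≤.antisym (sq-cancel-≤ (inj₁ 0<1) (inj₂ x²≈1)) (sq-cancel-≤ (inj₁ 0<x) (inj₂ (sym x²≈1)))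
    direction = rootDirection 0≤∣ z ∣ ∣ z ∣-square z≯0 λ z≈0 →
      0<⇒≉0 0<1 (trans (sym z≈1) (trans (normSq-cong {z} {ℂ.0#} z≈0) (trans (normSq-fromℝ 0#) (zeroˡ 0#))))

  -- Off the positive axis the half-plane argument excludes a root. On it, uniqueness of arm values
  -- replaces the given `f` by the real arms, so the equation becomes one for the real function
  -- `star`.
  star-root-real : ∀ {n} m (b : Vector ℕ n) z (f : Vector ℂ.Carrier n) → 1# < ℂ.normSq z →
    (∀ i → IsArm (suc (b i)) z (f i)) → star-value m f z ℂ.≈ ℂ.0# →
    ∃[ x ] 1# < x × z ℂ.≈ ℂ.fromℝ x × star m b x ≈ 0#
  star-root-real m b z@(x , y) f 1<z f-arm root with y <.≟ 0# | <.compare 0# x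
  ... | yes y≈0 | tri< 0<x _ _ = x , 1<x , z≈x , proj₁ (begin
      ℂ.fromℝ (star m b x)                                        ≈⟨ fromℝ-star m b x ⟨
      star-value m (λ i → ℂ.fromℝ (arm (b i) x)) (ℂ.fromℝ x)
        ≈⟨ ℂ×.+-cong (ℂ×.+-congʳ {ℂ.1#} (ℂ×.sym z≈x)) (ℂ×.-‿cong (ℂ×.+-congˡ {m ℂ.· ℂ.1#} (sum-cong f≈))) ⟩
      star-value m f z                                            ≈⟨ root ⟩
      ℂ.0#                                                        ∎)
    where
    open import Relation.Binary.Reasoning.Setoid ℂ×.setoid
    open import Algebra.Properties.Semiring.Sum ℂ×.semiring using () renaming (sum-cong-≋ to sum-cong)
    z≈x : z ℂ.≈ ℂ.fromℝ x
    z≈x = refl , y≈0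
    1<x : 1# < x
    1<x = sq-cancel-< (inj₁ 0<x) (<.<-respˡ-≈ (sym (*-identityʳ 1#))
      (<.<-respʳ-≈ (trans (normSq-cong {z} {ℂ.fromℝ x} z≈x) (normSq-fromℝ x)) 1<z))
    f≈ : ∀ i → ℂ.fromℝ (arm (b i) x) ℂ.≈ f i
    f≈ i = IsArm-unique {ℂ.fromℝ x} {suc (b i)} (^-1≉0 {ℂ.fromℝ x} (1<normSq-fromℝ 1<x) (b i))
      (fromℝ-arm (inj₁ 1<x) (b i)) (IsArm-resp {suc (b i)} {z} {ℂ.fromℝ x} {f i} z≈x (f-arm i))
  ... | no y≉0  | _ = contradiction root (star-value-not-positive m b z f 1<z f-arm (y≉0 ∘ proj₂))
  ... | yes _   | tri≈ 0≮x _ _ = contradiction root (star-value-not-positive m b z f 1<z f-arm (0≮x ∘ proj₁))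
  ... | yes _   | tri> 0≮x _ _ = contradiction root (star-value-not-positive m b z f 1<z f-arm (0≮x ∘ proj₁))

increasing-≥ : ∀ {n} (a : Vector ℕ (suc n)) → 2 ℕ.≤ a zero → StrictlyIncreasing a → ∀ i → 2 ℕ.≤ a i
increasing-≥ a 2≤a₀ a↑ zero    = 2≤a₀
increasing-≥ a 2≤a₀ a↑ (suc i) = ℕ.≤-trans 2≤a₀ (ℕ.<⇒≤ (a↑ (s≤s z≤n)))

-- The Pisot root, the Salem roots and their convergence.

module Convergence (em : ExcludedMiddle 0ℓ) (ℝ : CompleteOrderedField) where
  open CompleteOrderedField ℝ hiding (zero)
  open RealAndComplex ℝ
    using (fromℤ; fromℚ; monicEval; Q; coxeterPolynomial; IsPisot; IsDominantRoot; IsSalemRoot; IsConjugate; ≮⇒≥)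
  open IntegerSolver commutativeRing
  open RealAnalysis ℝ
  open RealArms ℝ
  open ComplexField ℝ
  open Embeddings ℝ
  open StarRoots ℝ
  open StarAlgebra ℂ-commutativeRing ℂ._⁻¹ ℂ-⁻¹-inverseʳ
  open RawSemiringDefinitions (Semiring.rawSemiring semiring) using (sum; _^_) renaming (_×_ to _·_)

  -- `F` is quantified after `c`, so that one tail serves the arms at every x. The last component
  -- traces each entry of `c` to a position from `k` on, where the entries of `a` are assumed large.
  split-arms : ∀ k {p n} → n ≡ k ℕ.+ p → (a : Vector ℕ n) (h : Vector ℕ k) .(k≤n : k ℕ.≤ n) →
    (∀ i → a (inject≤ i k≤n) ≡ h i) →
    ∃[ c ] (∀ (F : ℕ → Carrier) → sum (F ∘ a) ≈ sum (F ∘ h) + sum {p} (F ∘ c)) ×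
           (∀ j → ∃[ i ] k ℕ.≤ toℕ i × c j ≡ a i)
  split-arms zero ≡.refl a h _ _ = a , (λ F → sym (+-identityˡ _)) , λ j → j , z≤n , ≡.refl
  split-arms (suc k) ≡.refl a h k≤n a≡h with split-arms k ≡.refl (tail a) (tail h) (ℕ.s≤s⁻¹ k≤n) (a≡h ∘ suc)
  ... | c , sums , c⊆a =
    c , (λ F → trans (+-cong (reflexive (≡.cong F (a≡h zero))) (sums F)) (sym (+-assoc _ _ _))) ,
    λ j → let i , k≤i , cj≡ai = c⊆a j in suc i , s≤s k≤i , cj≡ai

  module Arms {n} (a : Vector ℕ (suc n)) (2≤a : ∀ i → 2 ℕ.≤ a i) where
    b : Vector ℕ (suc n)
    b i = a i ℕ.∸ 1

    1≤a : ∀ i → 1 ℕ.≤ a i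
    1≤a i = ℕ.<⇒≤ (2≤a i)

    1≤b : ∀ i → 1 ℕ.≤ b i
    1≤b i = ℕ.∸-monoˡ-≤ 1 (2≤a i)

    1+b≡a : ∀ i → suc (b i) ≡ a i
    1+b≡a i = ℕ.m+[n∸m]≡n (1≤a i)

    D : ℂ.Carrier → Vector ℂ.Carrier (suc n)
    D z i = z ℂ.^ a i ℂ.- ℂ.1#

    D≉0 : ∀ {z} → 1# < ℂ.normSq z → ∀ i → ¬ D z i ℂ.≈ ℂ.0#
    D≉0 {z} 1<z i = ≡.subst (λ e → ¬ z ℂ.^ e ℂ.- ℂ.1# ℂ.≈ ℂ.0#) (1+b≡a i) (^-1≉0 {z} 1<z (b i))

    arms : ℂ.Carrier → Vector ℂ.Carrier (suc n)
    arms z i = (z ℂ.^ a i ℂ.- z) / D z i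

    arms-IsArm : ∀ z → (∀ i → ¬ D z i ℂ.≈ ℂ.0#) → ∀ i → IsArm (a i) z (arms z i)
    arms-IsArm z Dz≉0 i = IsArm-/ {z} {a i} (Dz≉0 i)

    real-arms-IsArm : ∀ {x} → 1# < x → ∀ i → IsArm (a i) (ℂ.fromℝ x) (ℂ.fromℝ (arm (b i) x))
    real-arms-IsArm {x} 1<x i = ≡.subst (λ e → IsArm e (ℂ.fromℝ x) (ℂ.fromℝ (arm (b i) x))) (1+b≡a i)
      (fromℝ-arm (inj₁ 1<x) (b i))

    star-value-root : ∀ m {x} → star m b x ≈ 0# →
                      star-value m (λ i → ℂ.fromℝ (arm (b i) x)) (ℂ.fromℝ x) ℂ.≈ ℂ.0#
    star-value-root m {x} root = ℂ×.trans (fromℝ-star m b x) (root , refl)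

    star-value-unique : ∀ m {x} → 1# < x → star m b x ≈ 0# → ∀ z → 1# < ℂ.normSq z →
                        star-value m (arms z) z ℂ.≈ ℂ.0# → z ℂ.≈ ℂ.fromℝ x
    star-value-unique m {x} 1<x x-root z 1<z z-root =
      let y , 1<y , z≈y , y-root = star-root-real m b z (arms z) 1<z
            (λ i → ≡.subst (λ e → IsArm e z (arms z i)) (≡.sym (1+b≡a i)) (arms-IsArm z (D≉0 {z} 1<z) i)) z-root
      in ℂ×.trans {z} {ℂ.fromℝ y} {ℂ.fromℝ x} z≈y (star-root-unique m b 1≤b (inj₁ 1<y) (inj₁ 1<x) y-root x-root , refl)

    module _ (r m : ℕ) (r≡m+n : r ≡ m ℕ.+ n) where

      Q-root : ∀ {x} → 1# < x → star m b x ≈ 0# → Q r n a (ℂ.fromℝ x) ℂ.≈ ℂ.0#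
      Q-root {x} 1<x root = ℂ×.trans
        (Q-factor a 1≤a (ℂ.fromℝ x) f (real-arms-IsArm 1<x) r n m r≡m+n)
        (ℂ×.trans (ℂ×.*-congˡ {P} {star-value m f (ℂ.fromℝ x)} {ℂ.0#} (star-value-root m root)) (ℂ×.zeroʳ P))
        where
        f : Vector ℂ.Carrier (suc n)
        f i = ℂ.fromℝ (arm (b i) x)
        P = ℂ.product (D (ℂ.fromℝ x))

      Q⇒star-value : ∀ z → (∀ i → ¬ D z i ℂ.≈ ℂ.0#) → Q r n a z ℂ.≈ ℂ.0# → star-value m (arms z) z ℂ.≈ ℂ.0#
      Q⇒star-value z Dz≉0 root = *-zeroʳ⇒ {ℂ.product (D z)} {star-value m (arms z) z}
        (product-nonzero 1≉0 (D z) Dz≉0)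
        (ℂ×.trans (ℂ×.sym (Q-factor a 1≤a z (arms z) (arms-IsArm z Dz≉0) r n m r≡m+n)) root)

      Q-unique : ∀ {x} → 1# < x → star m b x ≈ 0# → ∀ z → 1# < ℂ.normSq z → Q r n a z ℂ.≈ ℂ.0# → z ℂ.≈ ℂ.fromℝ x
      Q-unique 1<x root z 1<z z-root =
        star-value-unique m 1<x root z 1<z (Q⇒star-value z (D≉0 {z} 1<z) z-root)

      -- By `Q-unique` all other roots, the roots of unity among them, lie in the closed unit disc.
      Q-dominant : ∀ {x} → 1# < x → star m b x ≈ 0# → IsDominantRoot (Q r n a) (ℂ.fromℝ x)
      Q-dominant {x} 1<x root = Q-root 1<x root , λ w w-root w≉x →
        ≤-<-trans (normSq≤⇒∣∣≤ w (inj₁ 0<1) (≤.trans (≮⇒≥ λ 1<w → w≉x (Q-unique 1<x root w 1<w w-root)) (inj₂ (sym (*-identityʳ 1#)))))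
          (1<normSq⇒1<∣∣ (ℂ.fromℝ x) (1<normSq-fromℝ 1<x))

      Q-pisot : ∀ {x} → 1 ℕ.≤ m → 1# < x → star m b x ≈ 0# → IsPisot x
      Q-pisot {x} 1≤m 1<x root = integer , 1<x , conjugates
        where
        module Minimal = ℚ[z].MinimalPolynomials em fromℚ-inverse 1≉0 (λ {z} {w} → *-zeroʳ⇒ {z} {w})
        X = ℂ.fromℝ x
        monic-Q = ℤ[z].Poly⇒monic (ℤ[z].Poly-Q a 2≤a r n)
        integer : ∃[ d ] ∃[ c ] monicEval fromℤ {d} c X ℂ.≈ ℂ.0#
        integer = _ , proj₁ monic-Q , ℂ×.trans (ℂ×.sym (proj₂ monic-Q X)) (Q-root 1<x root)
        Q-conjugate : ∀ {d} {c : Vector ℚ d} → Minimal.IsMinimal c X → ∀ w →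
                      monicEval fromℚ c w ℂ.≈ ℂ.0# → Q r n a w ℂ.≈ ℂ.0#
        Q-conjugate {c = c} minimal w cw≈0 =
          -- `Q` is monic over ℚ too, so the minimal polynomial of x divides it.
          let _ , s , _ , Q≈ = Minimal.minimal-∣ {X} {c = c} minimal (ℚ[z].Poly-Q a 2≤a r n) (Q-root 1<x root)
          in ℂ×.trans (Q≈ w) (ℂ×.trans (ℂ×.*-congʳ {s w} {monicEval fromℚ c w} {ℂ.0#} cw≈0) (ℂ×.zeroˡ (s w)))
        -- A conjugate that is a root of unity would force x to be one.
        D-conjugate : ∀ {d} {c : Vector ℚ d} → Minimal.IsMinimal c X → ∀ w →
                      monicEval fromℚ c w ℂ.≈ ℂ.0# → ∀ i → ¬ D w i ℂ.≈ ℂ.0#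
        D-conjugate {c = c} minimal w cw≈0 i w^≈1 = D≉0 {X} (1<normSq-fromℝ 1<x) i
          (Minimal.conjugate-root {X} {w} {c = c} minimal cw≈0
            (≡.subst (λ e → ℚ[z].Poly ℂ.1# e (λ z → z ℂ.^ e ℂ.- ℂ.1#)) (1+b≡a i) (ℚ[z].Poly-^-1 (b i))) w^≈1)
        conjugates : ∀ w → IsConjugate X w → ¬ w ℂ.≈ X → ℂ.∣ w ∣ < 1#
        conjugates w (d , c , minimal , cw≈0) w≉x with <.compare (ℂ.normSq w) 1#
        ... | tri< w<1 _ _ = normSq<⇒∣∣< w (inj₁ 0<1) (<.<-respʳ-≈ (sym (*-identityʳ 1#)) w<1)
        ... | tri> _ _ 1<w = contradiction (Q-unique 1<x root w 1<w (Q-conjugate {c = c} minimal w cw≈0)) w≉x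
        ... | tri≈ _ w≈1 _ = contradiction
          (Q⇒star-value w Dw≉0 (Q-conjugate {c = c} minimal w cw≈0))
          (star-value-unit-circle m a w (arms w) 1≤m w≈1 Dw≉0 (arms-IsArm w Dw≉0))
          where Dw≉0 = D-conjugate {c = c} minimal w cw≈0

    -- With all arms finite, the Coxeter polynomial is the star function times a product that has no
    -- zero outside the unit circle, so both have the same roots there.
    salemRoot : ∀ {x} → 1# < x → star 0 b x ≈ 0# → IsSalemRoot a x
    salemRoot {x} 1<x root = 1<x , coxeter-root , unique
      where
      P : ℂ.Carrier → ℂ.Carrier
      P z = ℂ.product (λ i → D z i / (z ℂ.- ℂ.1#))
      P≉0 : ∀ z → 1# < ℂ.normSq z → ¬ P z ℂ.≈ ℂ.0#
      P≉0 z 1<z = product-nonzero 1≉0 (λ i → D z i / (z ℂ.- ℂ.1#)) λ i →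
        /-nonzero {D z i} {z ℂ.- ℂ.1#} (D≉0 {z} 1<z i) λ z≈1 →
          ^-1≉0 {z} 1<z 0 (ℂ×.trans (ℂ×.+-congʳ {ℂ.- ℂ.1#} (ℂ×.*-identityʳ z)) z≈1)
      coxeter-root : coxeterPolynomial a (ℂ.fromℝ x) ℂ.≈ ℂ.0#
      coxeter-root = ℂ×.trans
        (coxeter-factor a 1≤a (ℂ.fromℝ x) f (real-arms-IsArm 1<x) (D≉0 {ℂ.fromℝ x} (1<normSq-fromℝ 1<x)))
        (ℂ×.trans (ℂ×.*-congˡ {P (ℂ.fromℝ x)} {star-value 0 f (ℂ.fromℝ x)} {ℂ.0#} (star-value-root 0 root)) (ℂ×.zeroʳ (P (ℂ.fromℝ x))))
        where
        f : Vector ℂ.Carrier (suc n)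
        f i = ℂ.fromℝ (arm (b i) x)
      unique : ∀ w → coxeterPolynomial a w ℂ.≈ ℂ.0# → 1# < ℂ.∣ w ∣ → w ℂ.≈ ℂ.fromℝ x
      unique w w-root 1<∣w∣ = star-value-unique 0 1<x root w 1<w
        (*-zeroʳ⇒ {P w} {star-value 0 (arms w) w} (P≉0 w 1<w)
          (ℂ×.trans (ℂ×.sym (coxeter-factor a 1≤a w (arms w) (arms-IsArm w (D≉0 {w} 1<w)) (D≉0 {w} 1<w))) w-root))
        where 1<w = 1<∣∣⇒1<normSq w 1<∣w∣

  ∣fromℝ-fromℝ∣<ε : ∀ {x y ε} → y - ε < x → x < y → ℂ.∣ ℂ.fromℝ x ℂ.- ℂ.fromℝ y ∣ < ε
  ∣fromℝ-fromℝ∣<ε {x} {y} {ε} y-ε<x x<y = normSq<⇒∣∣< (ℂ.fromℝ x ℂ.- ℂ.fromℝ y) (inj₁ 0<ε)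
    (<.<-respˡ-≈ (solve 2 (λ x y → (y :- x) :* (y :- x)
        := (x :- y) :* (x :- y) :+ (con (+ 0) :- con (+ 0)) :* (con (+ 0) :- con (+ 0))) refl x y)
      (*-mono-<-sq (inj₁ (<⇒0<- x<y)) y-x<ε))
    where
    y-x<ε : y - x < ε
    y-x<ε = 0<-⇒< (<⇒0<- y-ε<x) (solve 3 (λ x y e → e :- (y :- x) := x :- (y :- e)) refl x y ε)
    0<ε : 0# < ε
    0<ε = <.trans (<⇒0<- x<y) y-x<ε

  salemRoots-converge : ∀ {r k} (k<r : k ℕ.< r) (h : Vector ℕ (suc k)) (2≤h : ∀ i → 2 ℕ.≤ h i) →
    ∀ {θ} → 1# < θ → star (suc (r ℕ.∸ suc k)) (Arms.b h 2≤h) θ ≈ 0# → ∀ ε → 0# < ε →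
    ∃[ N ] ((a : Vector ℕ (suc r)) → StrictlyIncreasing a →
            (∀ i → a (inject≤ i (s≤s (ℕ.<⇒≤ k<r))) ≡ h i) →
            (∀ j → k ℕ.< toℕ j → N ℕ.≤ a j) →
            ∃[ τ ] IsSalemRoot a τ × ℂ.∣ ℂ.fromℝ τ ℂ.- ℂ.fromℝ θ ∣ < ε)
  salemRoots-converge {r} {k} k<r h 2≤h {θ} 1<θ root ε 0<ε = N , λ a a↑ a≡h N≤a →
    let c , sums , c⊆a = split-arms (suc k) 1+r≡ a h (s≤s (ℕ.<⇒≤ k<r)) a≡h
        2≤a = increasing-≥ a (≡.subst (2 ℕ.≤_) (≡.sym (a≡h zero)) (2≤h zero)) a↑
        -- The arm for `c j` has index `c j ∸ 1`; even with truncated subtraction `c j` is at most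
        -- `suc (c j ∸ 1)`, which is the form that the perturbation bound expects.
        N≤c = λ j → let i , k<i , cj≡ai = c⊆a j in
          ℕ.≤-trans (≡.subst (N ℕ.≤_) (≡.sym cj≡ai) (N≤a i k<i)) (ℕ.m≤n+m∸n (c j) 1)
        τ , 1<τ , θ-ε<τ , τ<θ , τ-root =
          proj₂ perturbed (Arms.b a 2≤a) (λ j → c j ℕ.∸ 1) (λ x → sums (λ n → arm (n ℕ.∸ 1) x)) N≤c
    in τ , Arms.salemRoot a 2≤a 1<τ τ-root , ∣fromℝ-fromℝ∣<ε θ-ε<τ τ<θ
    where
    perturbed = star-perturbed-root (Arms.b h 2≤h) (Arms.1≤b h 2≤h) em 1<θ root 0<ε
    N = proj₁ perturbed
    1+r≡ : suc r ≡ suc k ℕ.+ suc (r ℕ.∸ suc k)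
    1+r≡ = ≡.cong suc (≡.trans (≡.sym (ℕ.m+[n∸m]≡n k<r)) (≡.sym (ℕ.+-suc k (r ℕ.∸ suc k))))

open import Data.Nat.Base using (_≤_; _<_)
open import Data.Nat.Properties using (<⇒≤)

theorem3 :
    ExcludedMiddle 0ℓ →
    (ℝ : CompleteOrderedField) →
    let module ℝ = CompleteOrderedField ℝ
        open RealAndComplex ℝ
        open ℂ
    in
    (r k : ℕ) → 1 ≤ r → 1 ≤ k → (k<r : k < r) →
    (h : Vector ℕ (suc k)) → 2 ≤ h zero → StrictlyIncreasing h →
    ∃[ θ ]
      IsPisot θ ×
      IsDominantRoot (Q r k h) (fromℝ θ) ×
      (∀ ε → ℝ.0# ℝ.< ε →
       ∃[ N ] ((a : Vector ℕ (suc r)) → StrictlyIncreasing a →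
               (∀ i → a (inject≤ i (s≤s (<⇒≤ k<r))) ≡ h i) →
               (∀ j → k < toℕ j → N ≤ a j) →
               ∃[ τ ] IsSalemRoot a τ × ∣ fromℝ τ - fromℝ θ ∣ ℝ.< ε))
theorem3 em ℝ r (suc k) 1≤r 1≤k k<r h 2≤h₀ h↑ =
  θ , Q-pisot r m r≡m+k (s≤s z≤n) 1<θ root , Q-dominant r m r≡m+k 1<θ root ,
  salemRoots-converge k<r h 2≤h 1<θ root
  where
  open Convergence em ℝ
  2≤h = increasing-≥ h 2≤h₀ h↑
  open Arms h 2≤h
  -- The number of infinite arms, r minus the original k, written as a successor to show that it is
  -- positive; after the pattern match the original k is `suc k`.
  m = suc (r ℕ.∸ suc (suc k))
  r≡m+k : r ≡ m ℕ.+ suc k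
  r≡m+k = ≡.trans (≡.sym (ℕ.m∸n+n≡m k<r)) (ℕ.+-suc (r ℕ.∸ suc (suc k)) (suc k))
  -- A positive k provides the second finite arm, and strict increase from 2 gives a₁ ≥ 3, hence
  -- `b (suc zero)` is at least 2.
  existence = RealArms.star-root ℝ m b (s≤s z≤n) (1≤b zero)
    (ℕ.∸-monoˡ-≤ 1 (ℕ.≤-trans (s≤s 2≤h₀) (h↑ {zero} {suc zero} (s≤s z≤n))))
  θ = proj₁ existence
  1<θ = proj₁ (proj₂ existence)
  root = proj₂ (proj₂ existence)
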